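{- Let $B$ be a non-empty (having at least one edge) prime orientable bouquet. Then ${}^{\partial}\varepsilon_{B}(z)=2^{e(B)}z^{b}$ for some integer $b\ge 0$ if and only if $B=B_{2i+1}$ for some integer $i\ge 0$, where $B_t$ denotes the bouquet with signed rotation $(1,2,\ldots,t,1,2,\ldots,t)$.
   Context: Ribbon graphs are finite, possibly non-orientable, considered up to equivalence. For a ribbon graph $G$, let $v(G),e(G),f(G)$ be its numbers of vertices, edges and boundary components. For connected $G$ the Euler genus $\varepsilon(G)$ is defined by $2-\varepsilon(G)=v(G)-e(G)+f(G)$. For $A\subseteq E(G)$ the partial dual $G^{A}$ is obtained as follows: take the spanning ribbon subgraph $(V(G),A)$, glue a disc to $G$ along each boundary component of this subgraph (these discs are the vertex-discs of $G^A$), and remove the interiors of all vertex-discs of $G$; the edge-ribbons are kept as the edges of $G^A$. The partial-dual Euler genus polynomial of $G$ is ${}^{\partial}\varepsilon_{G}(z)=\sum_{A\subseteq E(G)}z^{\varepsilon(G^{A})}$. A bouquet is a ribbon graph with exactly one vertex. A loop $e$ at the vertex-disc $v$ is twisted if $e\cup v$ is homeomorphic to a Möbius band, and untwisted otherwise. A bouquet is orientable if and only if all its edges are untwisted loops. A bouquet is represented by a signed rotation: the cyclic ordering of its half-edges around the vertex, where the two half-edges of an untwisted loop get the same sign $+$ and the two half-edges of a twisted loop get different signs; the sign $+$ is omitted (so all loops of $B_t$ are untwisted). The intersection graph $I(B)$ of a bouquet $B$ is the graph with vertex set $E(B)$ in which distinct $e$ and $f$ are adjacent if and only if their ends are met in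 the cyclic order $e\cdots f\cdots e\cdots f\cdots$ when travelling around the boundary of the unique vertex of $B$. A bouquet is prime if its intersection graph is connected. -}

module Defs where

open import Data.Bool using (Bool; true; false; not; if_then_else_; _xor_)
import Data.Bool.Properties as Bool
open import Data.Fin using (Fin; toℕ)
import Data.Fin.Properties as Fin
open import Data.Fin.Subset using (Subset; inside; outside)
open import Data.Integer using (ℤ; +_; _-_) renaming (_+_ to _+ℤ_)
import Data.Integer.Properties as ℤ
open import Data.List using (List; []; _∷_; _++_; map; foldr; length; deduplicate; allFin; cartesianProduct)
open import Data.List.Membership.Propositional using (_∈_)
open import Data.List.Membership.Propositional.Properties
  using (∈-map⁺; ∈-map⁻; ∈-++⁺ˡ; ∈-++⁺ʳ; ∈-++⁻; ∈-cartesianProduct⁺; ∈-allFin)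
open import Data.List.Relation.Unary.Any using (here; there)
open import Data.Nat using (ℕ; zero; suc; _+_; _*_; _<_; NonZero)
open import Data.Nat.DivMod using (_mod_; _%_; %-distribˡ-+; m%n%n≡m%n; [m+n]%n≡m%n; m<n⇒m%n≡m; m%n<n)
open import Data.Nat.GeneralisedArithmetic using (iterate)
import Data.Nat.Properties as ℕ
open import Data.Product using (_×_; _,_; proj₁; ∃-syntax; Σ-syntax)
open import Data.Product.Algebra using (×-comm)
open import Data.Product.Function.NonDependent.Propositional using (_×-↔_)
open import Data.Product.Properties using (≡-dec)
open import Data.Sign using (Sign)
open import Data.Sum using (_⊎_; inj₁; inj₂)
open import Data.Vec using ([]; _∷_; lookup)
open import Function using (_∘_; _↔_; Inverse)
open import Function.Properties.Inverse using (↔-refl; ↔-sym; ↔-trans)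
open import Relation.Binary using (Rel; DecidableEquality)
open import Relation.Binary.Construct.Closure.Equivalence as Eq using (EqClosure)
open import Relation.Binary.Construct.Closure.ReflexiveTransitive using (Star; ε; _◅_)
open import Relation.Binary.Construct.Closure.Symmetric using (fwd; bwd)
open import Relation.Binary.PropositionalEquality
open import Relation.Nullary using (Dec; does)
open import Relation.Nullary.Decidable using (map′; _⊎-dec_; _×-dec_)

-- An edge-ribbon is a rectangle with two opposite ends, glued to the
-- vertex-discs, and two opposite free sides.  The corner (i , h , s) is the
-- point of edge i where end h meets side s.

Corner : ℕ → Set
Corner n = Fin n × Bool × Bool

edgeOf : ∀ {n} → Corner n → Fin n
edgeOf = proj₁

-- The other corner on the same end.

end : ∀ {n} → Corner n → Corner n
end (i , h , s) = i , h , not s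

-- The other corner on the same side.

side : ∀ {n} → Corner n → Corner n
side (i , h , s) = i , not h , s

-- The boundaries of the vertex-discs that meet an edge are cut by the edge
-- ends into arcs; `arc` sends a corner to the other endpoint of the arc
-- starting there.  The remaining vertex-discs are only counted.

record RibbonGraph : Set where
  field
    edges          : ℕ
    isolated       : ℕ
    arc            : Corner edges → Corner edges
    arc-involutive : ∀ c → arc (arc c) ≡ c
    arc-free       : ∀ c → arc c ≢ c

open RibbonGraph public

infix 4 _≅_

-- Equivalence of ribbon graphs: a homeomorphism carrying vertex-discs to
-- vertex-discs and edge-ribbons to edge-ribbons is determined, up to isotopy,
-- by its effect on corners.

record _≅_ (G H : RibbonGraph) : Set where
  field
    corners       : Corner (edges G) ↔ Corner (edges H)
    end-commutes  : ∀ c → Inverse.to corners (end c) ≡ end (Inverse.to corners c)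
    side-commutes : ∀ c → Inverse.to corners (side c) ≡ side (Inverse.to corners c)
    arc-commutes  : ∀ c → Inverse.to corners (arc G c) ≡ arc H (Inverse.to corners c)
    isolated-≡    : isolated G ≡ isolated H

-- Deciding the equivalence relation generated by a finite list of pairs.

module _ {X : Set} (_≟_ : DecidableEquality X) where

  private
    Gen : List (X × X) → Rel X _
    Gen L x y = (x , y) ∈ L

    Merged : X → X → List (X × X) → Rel X _
    Merged a b L x y =
      EqClosure (Gen L) x y
      ⊎ (EqClosure (Gen L) x a × EqClosure (Gen L) b y)
      ⊎ (EqClosure (Gen L) x b × EqClosure (Gen L) a y)

    weaken : ∀ {p L x y} → EqClosure (Gen L) x y → EqClosure (Gen (p ∷ L)) x y
    weaken = Eq.map there

    merged⇒ : ∀ {a b L x y} → Merged a b L x y → EqClosure (Gen ((a , b) ∷ L)) x y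
    merged⇒ (inj₁ r) = weaken r
    merged⇒ (inj₂ (inj₁ (r , s))) =
      Eq.transitive _ (weaken r) (fwd (here refl) ◅ weaken s)
    merged⇒ (inj₂ (inj₂ (r , s))) =
      Eq.transitive _ (weaken r) (bwd (here refl) ◅ weaken s)

    ⇒merged : ∀ {a b L x y} → EqClosure (Gen ((a , b) ∷ L)) x y → Merged a b L x y
    ⇒merged ε = inj₁ ε
    ⇒merged (fwd (there m) ◅ r) with ⇒merged r
    ... | inj₁ s              = inj₁ (fwd m ◅ s)
    ... | inj₂ (inj₁ (s , t)) = inj₂ (inj₁ (fwd m ◅ s , t))
    ... | inj₂ (inj₂ (s , t)) = inj₂ (inj₂ (fwd m ◅ s , t))
    ⇒merged (bwd (there m) ◅ r) with ⇒merged r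
    ... | inj₁ s              = inj₁ (bwd m ◅ s)
    ... | inj₂ (inj₁ (s , t)) = inj₂ (inj₁ (bwd m ◅ s , t))
    ... | inj₂ (inj₂ (s , t)) = inj₂ (inj₂ (bwd m ◅ s , t))
    ⇒merged (fwd (here refl) ◅ r) with ⇒merged r
    ... | inj₁ s              = inj₂ (inj₁ (ε , s))
    ... | inj₂ (inj₁ (s , t)) = inj₂ (inj₁ (ε , t))
    ... | inj₂ (inj₂ (s , t)) = inj₁ t
    ⇒merged (bwd (here refl) ◅ r) with ⇒merged r
    ... | inj₁ s              = inj₂ (inj₂ (ε , s))
    ... | inj₂ (inj₁ (s , t)) = inj₁ t
    ... | inj₂ (inj₂ (s , t)) = inj₂ (inj₂ (ε , t))

  generated? : ∀ L x y → Dec (EqClosure (λ u v → (u , v) ∈ L) x y)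
  generated? [] x y = map′ (λ { refl → ε }) empty (x ≟ y)
    where
    empty : EqClosure (λ u v → (u , v) ∈ []) x y → x ≡ y
    empty ε = refl
    empty (fwd () ◅ _)
    empty (bwd () ◅ _)
  generated? ((a , b) ∷ L) x y = map′ merged⇒ ⇒merged
    (generated? L x y
      ⊎-dec (generated? L x a ×-dec generated? L b y)
      ⊎-dec (generated? L x b ×-dec generated? L a y))

allCorners : ∀ n → List (Corner n)
allCorners n =
  cartesianProduct (allFin n) (cartesianProduct (false ∷ true ∷ []) (false ∷ true ∷ []))

∈-allCorners : ∀ {n} (c : Corner n) → c ∈ allCorners n
∈-allCorners (i , h , s) = ∈-cartesianProduct⁺ (∈-allFin i) (∈-cartesianProduct⁺ (∈-bools h) (∈-bools s))
  where
  ∈-bools : ∀ b → b ∈ false ∷ true ∷ []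
  ∈-bools false = here refl
  ∈-bools true  = there (here refl)

module _ {n} (p q : Corner n → Corner n) where

  SameOrbit : Rel (Corner n) _
  SameOrbit = EqClosure (λ c d → p c ≡ d ⊎ q c ≡ d)

  private
    graph : (Corner n → Corner n) → List (Corner n × Corner n)
    graph r = map (λ c → c , r c) (allCorners n)

    ∈-graph : ∀ r c → (c , r c) ∈ graph r
    ∈-graph r c = ∈-map⁺ (λ c → c , r c) (∈-allCorners c)

    link⇒∈ : ∀ {c d} → p c ≡ d ⊎ q c ≡ d → (c , d) ∈ graph p ++ graph q
    link⇒∈ (inj₁ refl) = ∈-++⁺ˡ (∈-graph p _)
    link⇒∈ (inj₂ refl) = ∈-++⁺ʳ (graph p) (∈-graph q _)

    ∈⇒link : ∀ {c d} → (c , d) ∈ graph p ++ graph q → p c ≡ d ⊎ q c ≡ d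
    ∈⇒link m with ∈-++⁻ (graph p) m
    ... | inj₁ m′ with ∈-map⁻ _ m′
    ...   | _ , _ , refl = inj₁ refl
    ∈⇒link m | inj₂ m′ with ∈-map⁻ _ m′
    ...   | _ , _ , refl = inj₂ refl

  sameOrbit? : ∀ c d → Dec (SameOrbit c d)
  sameOrbit? c d = map′ (Eq.map ∈⇒link) (Eq.map link⇒∈)
    (generated? (≡-dec Fin._≟_ (≡-dec Bool._≟_ Bool._≟_)) (graph p ++ graph q) c d)

  orbits : ℕ
  orbits = length (deduplicate sameOrbit? (allCorners n))

-- The boundary of a vertex-disc alternates between arcs and edge ends, and a
-- boundary component of G alternates between arcs and edge sides.

e v f : RibbonGraph → ℕ
e G = edges G
v G = orbits end (arc G) + isolated G
f G = orbits side (arc G) + isolated G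

-- To be used for connected G only.

eulerGenus : RibbonGraph → ℤ
eulerGenus G = + 2 - ((+ v G - + e G) +ℤ + f G)

conjugate : ∀ {X : Set} → (X → X) → (X → X) → X → X
conjugate φ r = φ ∘ r ∘ φ

module _ {X : Set} (φ r : X → X) (φ-involutive : ∀ x → φ (φ x) ≡ x) where

  conjugate-involutive : (∀ x → r (r x) ≡ x) → ∀ x → conjugate φ r (conjugate φ r x) ≡ x
  conjugate-involutive r-involutive x =
    trans (cong (φ ∘ r) (φ-involutive _)) (trans (cong φ (r-involutive _)) (φ-involutive x))

  conjugate-free : (∀ x → r x ≢ x) → ∀ x → conjugate φ r x ≢ x
  conjugate-free r-free x eq = r-free (φ x) (trans (sym (φ-involutive _)) (cong φ eq))

-- A boundary component of the spanning ribbon subgraph (V(G) , A) runs along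
-- the arcs of G, along the sides of the edges in A, and along the ends of the
-- edges not in A.  Discs glued along these curves are the new vertices, so the
-- new graph has the same corners and the same arcs, but on the edges in A the
-- roles of ends and sides are interchanged; `exchange` restores the naming
-- convention for corners.  An isolated vertex-disc is replaced by another one.

exchange : ∀ {n} → Subset n → Corner n → Corner n
exchange A (i , h , s) = if lookup A i then (i , s , h) else (i , h , s)

exchange-involutive : ∀ {n} (A : Subset n) c → exchange A (exchange A c) ≡ c
exchange-involutive A (i , h , s) with lookup A i in eq
... | true  rewrite eq = refl
... | false rewrite eq = refl

partialDual : (G : RibbonGraph) → Subset (e G) → RibbonGraph
partialDual G A = record
  { edges          = edges G
  ; isolated       = isolated G
  ; arc            = conjugate (exchange A) (arc G)
  ; arc-involutive = conjugate-involutive (exchange A) (arc G) (exchange-involutive A) (arc-involutive G)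
  ; arc-free       = conjugate-free (exchange A) (arc G) (exchange-involutive A) (arc-free G)
  }

-- Polynomials as coefficient functions.  Exponents range over ℤ because
-- `eulerGenus` takes values in ℤ; its non-negativity is not built in.

Poly : Set
Poly = ℤ → ℕ

infix  4 _≈_
infixl 6 _⊕_
infixr 7 _·_
infix  8 z^_

_≈_ : Poly → Poly → Set
P ≈ Q = ∀ k → P k ≡ Q k

0ᵖ : Poly
0ᵖ _ = 0

_⊕_ : Poly → Poly → Poly
(P ⊕ Q) k = P k + Q k

_·_ : ℕ → Poly → Poly
(a · P) k = a * P k

z^_ : ℤ → Poly
(z^ m) k = if does (k ℤ.≟ m) then 1 else 0

subsets : ∀ n → List (Subset n)
subsets zero    = [] ∷ []
subsets (suc n) = map (outside ∷_) (subsets n) ++ map (inside ∷_) (subsets n)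

∂ε : RibbonGraph → Poly
∂ε G = foldr _⊕_ 0ᵖ (map (λ A → z^ eulerGenus (partialDual G A)) (subsets (e G)))

Bouquet : RibbonGraph → Set
Bouquet G = v G ≡ 1

-- Direct the boundary circle of every vertex-disc and of every edge-ribbon.
-- Let o c tell whether the end at c is directed away from c by its vertex-disc.
-- Consistency around vertex-discs says that o alternates along ends and arcs.
-- The directions fit together to an orientation of the surface when edge-ribbons
-- direct the ends oppositely to vertex-discs; consistency around edge-ribbons
-- then says that o also alternates along sides.

Orientable : RibbonGraph → Set
Orientable G = Σ[ o ∈ (Corner (e G) → Bool) ]
  (∀ c → o (end c) ≡ not (o c)) ×
  (∀ c → o (side c) ≡ not (o c)) ×
  (∀ c → o (arc G c) ≡ not (o c))

-- Going around a vertex-disc: cross the end at the current corner and follow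
-- the arc to the next end.

walk : (G : RibbonGraph) → Corner (e G) → ℕ → Corner (e G)
walk G = iterate (arc G ∘ end)

-- The intersection graph of a bouquet.  A full turn around the only vertex has
-- 2 e(G) steps and meets every edge end exactly once.

Interlaced : (G : RibbonGraph) → Rel (Fin (e G)) _
Interlaced G x y = x ≢ y × ∃[ c ] ∃[ i ] ∃[ j ] ∃[ k ]
  (0 < i × i < j × j < k × k < 2 * e G) ×
  edgeOf c ≡ x × edgeOf (walk G c i) ≡ y ×
  edgeOf (walk G c j) ≡ x × edgeOf (walk G c k) ≡ y

Prime : RibbonGraph → Set
Prime G = ∀ x y → EqClosure (Interlaced G) x y

HalfEdge : ℕ → Set
HalfEdge n = Fin n × Bool

-- `position` places the half-edges in the cyclic order 0, 1, …, 2n - 1, 0.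

record SignedRotation (n : ℕ) : Set where
  field
    position : HalfEdge n ↔ Fin (2 * n)
    sign     : HalfEdge n → Sign

next prev : ∀ {m} → Fin m → Fin m
next {suc m} i = suc (toℕ i) mod suc m
prev {suc m} i = (toℕ i + m) mod suc m

private
  toℕ-mod : ∀ a m .{{_ : NonZero m}} → toℕ (a mod m) ≡ a % m
  toℕ-mod a m = Fin.toℕ-fromℕ< (m%n<n a m)

  shift-% : ∀ a b m .{{_ : NonZero m}} → (a % m + b) % m ≡ (a + b) % m
  shift-% a b m = trans (%-distribˡ-+ (a % m) b m)
    (trans (cong (λ t → (t + b % m) % m) (m%n%n≡m%n a m)) (sym (%-distribˡ-+ a b m)))

  wrap-% : ∀ {m} (i : Fin (suc m)) → (toℕ i + suc m) % suc m ≡ toℕ i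
  wrap-% {m} i = trans ([m+n]%n≡m%n (toℕ i) (suc m)) (m<n⇒m%n≡m (Fin.toℕ<n i))

prev-next : ∀ {m} (i : Fin m) → prev (next i) ≡ i
prev-next {suc m} i = Fin.toℕ-injective (begin
  toℕ (prev (next i))                     ≡⟨ toℕ-mod (toℕ (next i) + m) (suc m) ⟩
  (toℕ (next i) + m) % suc m              ≡⟨ cong (λ t → (t + m) % suc m) (toℕ-mod (suc (toℕ i)) (suc m)) ⟩
  (suc (toℕ i) % suc m + m) % suc m       ≡⟨ shift-% (suc (toℕ i)) m (suc m) ⟩
  (suc (toℕ i) + m) % suc m               ≡⟨ cong (_% suc m) (sym (ℕ.+-suc (toℕ i) m)) ⟩
  (toℕ i + suc m) % suc m                 ≡⟨ wrap-% i ⟩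
  toℕ i                                   ∎)
  where open ≡-Reasoning

next-prev : ∀ {m} (i : Fin m) → next (prev i) ≡ i
next-prev {suc m} i = Fin.toℕ-injective (begin
  toℕ (next (prev i))                     ≡⟨ toℕ-mod (suc (toℕ (prev i))) (suc m) ⟩
  suc (toℕ (prev i)) % suc m              ≡⟨ cong (λ t → suc t % suc m) (toℕ-mod (toℕ i + m) (suc m)) ⟩
  suc ((toℕ i + m) % suc m) % suc m       ≡⟨ cong (_% suc m) (ℕ.+-comm 1 _) ⟩
  ((toℕ i + m) % suc m + 1) % suc m       ≡⟨ shift-% (toℕ i + m) 1 (suc m) ⟩
  (toℕ i + m + 1) % suc m                 ≡⟨ cong (_% suc m) (trans (ℕ.+-assoc (toℕ i) m 1) (cong (λ t → toℕ i + t) (ℕ.+-comm m 1))) ⟩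
  (toℕ i + suc m) % suc m                 ≡⟨ wrap-% i ⟩
  toℕ i                                   ∎)
  where open ≡-Reasoning

module _ {n : ℕ} (R : SignedRotation n) where
  open SignedRotation R
  open Inverse position using (to; from; strictlyInverseˡ; strictlyInverseʳ)

  -- The side of the edge at the corner of a half-edge that comes first in the
  -- cyclic order.  In an annulus a side joins a first corner to a second one,
  -- in a Möbius band it joins two first or two second corners; so the first
  -- corners of a loop must lie on different sides for equal signs and on the
  -- same side for different signs.

  firstSide : HalfEdge n → Bool
  firstSide (i , h) with sign (i , h)
  ... | Sign.+ = h
  ... | Sign.- = not h

  -- Renames corners so that (i , h , false) is the first corner of (i , h).

  sort : Corner n → Corner n
  sort (i , h , s) = i , h , s xor firstSide (i , h)

  sort-involutive : ∀ c → sort (sort c) ≡ c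
  sort-involutive (i , h , s) = cong (λ t → i , h , t)
    (trans (Bool.xor-assoc s _ _)
      (trans (cong (s xor_) (Bool.xor-same (firstSide (i , h)))) (Bool.xor-identityʳ s)))

  nextHalf prevHalf : HalfEdge n → HalfEdge n
  nextHalf = from ∘ next ∘ to
  prevHalf = from ∘ prev ∘ to

  prev-nextHalf : ∀ x → prevHalf (nextHalf x) ≡ x
  prev-nextHalf x = trans (cong (from ∘ prev) (strictlyInverseˡ _))
    (trans (cong from (prev-next (to x))) (strictlyInverseʳ x))

  next-prevHalf : ∀ x → nextHalf (prevHalf x) ≡ x
  next-prevHalf x = trans (cong (from ∘ next) (strictlyInverseˡ _))
    (trans (cong from (next-prev (to x))) (strictlyInverseʳ x))

  corner : HalfEdge n → Bool → Corner n
  corner (i , h) s = i , h , s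

  sortedArc : Corner n → Corner n
  sortedArc (i , h , true)  = corner (nextHalf (i , h)) false
  sortedArc (i , h , false) = corner (prevHalf (i , h)) true

  sortedArc-involutive : ∀ c → sortedArc (sortedArc c) ≡ c
  sortedArc-involutive (i , h , true)  = cong (λ x → corner x true) (prev-nextHalf (i , h))
  sortedArc-involutive (i , h , false) = cong (λ x → corner x false) (next-prevHalf (i , h))

  sortedArc-free : ∀ c → sortedArc c ≢ c
  sortedArc-free (i , h , true)  ()
  sortedArc-free (i , h , false) ()

  fromRotation : RibbonGraph
  fromRotation = record
    { edges          = n
    ; isolated       = noEdges n
    ; arc            = conjugate sort sortedArc
    ; arc-involutive = conjugate-involutive sort sortedArc sort-involutive sortedArc-involutive
    ; arc-free       = conjugate-free sort sortedArc sort-involutive sortedArc-free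
    }
    where
    noEdges : ℕ → ℕ
    noEdges zero    = 1
    noEdges (suc _) = 0

-- (1, 2, …, t, 1, 2, …, t): the half-edges (i , false) and (i , true) have
-- positions i and t + i.

B[_] : ℕ → RibbonGraph
B[ t ] = fromRotation record
  { position = ↔-trans (×-comm (Fin t) Bool) (↔-trans (↔-sym Fin.2↔Bool ×-↔ ↔-refl) (↔-sym (Fin.*↔× {2} {t})))
  ; sign     = λ _ → Sign.+
  }

-- Let F A be the number of boundary components of the spanning ribbon subgraph
-- with edge set A.  These are the vertices of G^A, and the boundary components
-- of G^A are counted by F (∁ A), so the polynomial is a monomial if and only if
-- F A + F (∁ A) does not depend on A.
--
-- Adding an edge x to A changes F A by one, according to whether the two sides
-- of x lie on the same boundary component.  If F A + F (∁ A) is constant, then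
-- the sides of x lie on the same component for A if and only if they do not for
-- ∁ A.  Apply this to A = {y}, with x ≠ y: in the bouquet the sides of x are
-- separated by y if and only if x and y are interlaced; in the complement they
-- are together if and only if x and y border the same pair of boundary components
-- of G.  The latter is an equivalence relation, so primality makes all pairs of
-- edges interlaced, that is, every edge joins antipodal points of the circle.
-- The number of edges is odd since F goes from F ∅ = 1 to F E = 2 in steps of ±1.
--
-- Conversely, if all edges join antipodal points, then the antipodal map permutes
-- the boundary components, and each of them is a given one or its image; so
-- F A ≤ 2.  When the number of edges is odd, F A and F (∁ A) have opposite
-- parities, hence sum 3.

module Submission where

open import Defs
open import Data.Integer using (+_)
open import Data.Nat using (_+_; _*_; _^_; _≤_)
open import Data.Product using (∃-syntax)
open import Function using (_⇔_)

open import Data.Bool using (Bool; true; false; not; if_then_else_; _xor_)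
import Data.Bool.Properties as Bool
open import Data.Fin using (Fin; zero; suc; toℕ; fromℕ<; punchIn; punchOut; combine; remQuot)
import Data.Fin.Permutation as Permutation
import Data.Fin.Properties as Fin
open import Data.Fin.Subset using (Subset; ∁; ⊥)
open import Data.Integer using (ℤ; _-_; _⊖_) renaming (_+_ to _+ℤ_)
import Data.Integer.Properties as ℤ
open import Algebra.Properties.AbelianGroup ℤ.+-0-abelianGroup using (∙-cancelˡ)
open import Data.Integer.Solver using (module +-*-Solver)
open import Data.List as List using (List; []; _∷_)
open import Data.List.Membership.Propositional using (_∈_)
open import Data.List.Membership.Propositional.Properties using (∈-map⁺; ∈-++⁺ˡ; ∈-++⁺ʳ; ∈-lookup)
import Data.List.Membership.Setoid.Properties as SetoidMembership
import Data.List.Properties as List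
import Data.List.Relation.Unary.All as All
open import Data.List.Relation.Unary.AllPairs using (AllPairs; []; _∷_)
open import Data.List.Relation.Unary.Any as Any using (Any; here; there; index)
open import Data.List.Relation.Unary.Any.Properties using (lookup-index)
import Data.List.Relation.Unary.Unique.DecSetoid.Properties as Unique
open import Data.Nat using (ℕ; zero; suc; _<_; s≤s; z≤n; z<s; s<s; NonZero; >-nonZero; parity)
open import Data.Nat.DivMod using (_%_; _/_; m%n<n; m<n⇒m%n≡m; m%n%n≡m%n; m≡m%n+[m/n]*n; [m+n]%n≡m%n; %-distribˡ-+)
open import Data.Nat.GeneralisedArithmetic using (iterate)
import Data.Nat.Properties as ℕ
open import Data.Parity using (Parity; 0ℙ; 1ℙ; _⁻¹) renaming (_+_ to _+ℙ_)
import Data.Parity.Properties as Parity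
open import Data.Product using (_×_; _,_; proj₁; proj₂; map₂)
open import Data.Product.Algebra using (×-comm)
open import Data.Product.Function.NonDependent.Propositional using (_×-↔_)
open import Data.Sign using (Sign)
open import Data.Sum using (_⊎_; inj₁; inj₂)
open import Data.Vec using ([]; _∷_; lookup; updateAt)
import Data.Vec.Properties as Vec
open import Function using (_∘_; Inverse; _↔_; mk⇔; mk↔ₛ′)
open import Function.Properties.Inverse using (↔-refl; ↔-sym; ↔-trans)
open import Level using (0ℓ)
open import Relation.Binary using (Rel; IsEquivalence; DecSetoid; _⇒_; tri<; tri≈; tri>)
import Relation.Binary.Construct.Closure.Equivalence as Eq
open import Relation.Binary.Construct.Closure.ReflexiveTransitive using (ε; _◅_)
open import Relation.Binary.Construct.Closure.Symmetric using (fwd; bwd)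
open import Relation.Binary.PropositionalEquality
open import Relation.Nullary using (¬_; yes; no; contradiction)

private variable
  X Y : Set
  E E′ : Rel X 0ℓ
  k l : ℕ

-- Counting equivalence classes

-- The quotient by E, presented as `Fin k` with a chosen section `rep`. The section is what makes k
-- an invariant of E.
record HasClasses {X : Set} (E : Rel X 0ℓ) (k : ℕ) : Set where
  field
    class     : X → Fin k
    rep       : Fin k → X
    class-rep : ∀ i → class (rep i) ≡ i
    sound     : ∀ {x y} → class x ≡ class y → E x y
    complete  : ∀ {x y} → E x y → class x ≡ class y

-- Sending a class to the label that the other system gives to its representative is injective.
classes-≤ : HasClasses E k → HasClasses E l → k ≤ l
classes-≤ K L = Fin.injective⇒≤ {f = L.class ∘ K.rep} λ {i} {j} eq →
  trans (sym (K.class-rep i)) (trans (K.complete (L.sound eq)) (K.class-rep j))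
  where
  module K = HasClasses K
  module L = HasClasses L

classes-unique : HasClasses E k → HasClasses E l → k ≡ l
classes-unique K L = ℕ.≤-antisym (classes-≤ K L) (classes-≤ L K)

classes-transfer : {E : Rel X 0ℓ} {E′ : Rel Y 0ℓ} (φ : X → Y) (ψ : Y → X) →
  (∀ y → φ (ψ y) ≡ y) →
  (∀ {x y} → E x y → E′ (φ x) (φ y)) → (∀ {x y} → E′ (φ x) (φ y) → E x y) →
  HasClasses E′ k → HasClasses E k
classes-transfer {E′ = E′} φ ψ φψ there′ back K = record
  { class     = class ∘ φ
  ; rep       = ψ ∘ rep
  ; class-rep = λ i → trans (cong class (φψ (rep i))) (class-rep i)
  ; sound     = back ∘ sound
  ; complete  = complete ∘ there′
  }
  where open HasClasses K

classes-≤2 : HasClasses E k → (a b : X) → (∀ x → E a x ⊎ E b x) → k ≤ 2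
classes-≤2 {k = k} K a b cover = Fin.injective⇒≤ {f = code} code-injective
  where
  open HasClasses K
  other : ∀ {i} → i ≢ class a → i ≡ class b
  other {i} i≢a with cover (rep i)
  ... | inj₁ r = contradiction (trans (sym (class-rep i)) (sym (complete r))) i≢a
  ... | inj₂ r = trans (sym (class-rep i)) (sym (complete r))
  code : Fin k → Fin 2
  code i with i Fin.≟ class a
  ... | yes _ = zero
  ... | no _  = suc zero
  code-injective : ∀ {i j} → code i ≡ code j → i ≡ j
  code-injective {i} {j} eq with i Fin.≟ class a | j Fin.≟ class a
  ... | yes p | yes q = trans p (sym q)
  ... | no p  | no q  = trans (other p) (sym (other q))
  code-injective () | yes _ | no _
  code-injective () | no _  | yes _

-- E′ is E with the classes of a and b united. The field `only` is explicit because a chain of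
-- relations needs the new pair at most once.
record Merges {X : Set} (E E′ : Rel X 0ℓ) (a b : X) : Set where
  field
    extends : E ⇒ E′
    joins   : E′ a b
    only    : ∀ {x y} → E′ x y → E x y ⊎ (E x a × E b y) ⊎ (E x b × E a y)

module _ {X : Set} {E : Rel X 0ℓ} {k : ℕ} (K : HasClasses E k) (a b : X) where
  open HasClasses K

  -- The class map of the merged relation, still with values in `Fin k`: the class of b receives the
  -- label of a. If the two classes differ, the label `class b` falls out of use.
  redirect : X → Fin k
  redirect x with class x Fin.≟ class b
  ... | yes _ = class a
  ... | no _  = class x

  redirect-complete : ∀ {x y} → E x y → redirect x ≡ redirect y
  redirect-complete {x} {y} r with class x Fin.≟ class b | class y Fin.≟ class b
  ... | yes p | yes q = refl
  ... | yes p | no q  = contradiction (trans (sym (complete r)) p) q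
  ... | no p  | yes q = contradiction (trans (complete r) q) p
  ... | no p  | no q  = complete r

  redirect-joins : redirect a ≡ redirect b
  redirect-joins with class a Fin.≟ class b | class b Fin.≟ class b
  ... | _     | no q  = contradiction refl q
  ... | yes p | yes _ = refl
  ... | no p  | yes _ = refl

  redirect-only : ∀ {x y} → redirect x ≡ redirect y → E x y ⊎ (E x a × E b y) ⊎ (E x b × E a y)
  redirect-only {x} {y} eq with class x Fin.≟ class b | class y Fin.≟ class b
  ... | yes p | yes q = inj₁ (sound (trans p (sym q)))
  ... | yes p | no q  = inj₂ (inj₂ (sound p , sound eq))
  ... | no p  | yes q = inj₂ (inj₁ (sound eq , sound (sym q)))
  ... | no p  | no q  = inj₁ (sound eq)

  redirect-avoids : class a ≢ class b → ∀ x → class b ≢ redirect x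
  redirect-avoids a≢b x eq with class x Fin.≟ class b
  ... | yes p = a≢b (sym eq)
  ... | no p  = p (sym eq)

  redirect-fixes : ∀ x → class x ≢ class b → redirect x ≡ class x
  redirect-fixes x x≢b with class x Fin.≟ class b
  ... | yes p = contradiction p x≢b
  ... | no p  = refl

-- The label `class b`, no longer used by `redirect`, is punched out of `Fin (suc k)`; what remains
-- labels the classes of E′.
classes-merge : IsEquivalence E′ → ∀ {a b} → Merges E E′ a b → ¬ E a b →
  HasClasses E k → HasClasses E′ l → k ≡ suc l
classes-merge {k = zero} _ {a = a} _ _ K _ with () ← HasClasses.class K a
classes-merge {E′ = E′} {k = suc k} E′-equiv {a} {b} M ¬Eab K L =
  cong suc (classes-unique merged L)
  where
  open HasClasses K
  open Merges M
  module E′ = IsEquivalence E′-equiv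
  a≢b : class a ≢ class b
  a≢b = ¬Eab ∘ sound
  g = redirect K a b
  avoids = redirect-avoids K a b a≢b
  back : ∀ {x y} → g x ≡ g y → E′ x y
  back eq with redirect-only K a b eq
  ... | inj₁ r              = extends r
  ... | inj₂ (inj₁ (r , s)) = E′.trans (extends r) (E′.trans joins (extends s))
  ... | inj₂ (inj₂ (r , s)) = E′.trans (extends r) (E′.trans (E′.sym joins) (extends s))
  forth : ∀ {x y} → E′ x y → g x ≡ g y
  forth r′ with only r′
  ... | inj₁ r              = redirect-complete K a b r
  ... | inj₂ (inj₁ (r , s)) = trans (redirect-complete K a b r)
    (trans (redirect-joins K a b) (redirect-complete K a b s))
  ... | inj₂ (inj₂ (r , s)) = trans (redirect-complete K a b r)
    (trans (sym (redirect-joins K a b)) (redirect-complete K a b s))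
  merged : HasClasses E′ k
  merged = record
    { class     = λ x → punchOut (avoids x)
    ; rep       = λ i → rep (punchIn (class b) i)
    ; class-rep = λ i → trans
        -- The representative of a label other than `class b` lies outside the class of b, so
        -- `redirect` leaves its label unchanged.
        (Fin.punchOut-cong (class b)
          (trans (redirect-fixes K a b _ (λ eq →
                   Fin.punchInᵢ≢i (class b) i (trans (sym (class-rep _)) eq)))
                 (class-rep _)))
        (Fin.punchOut-punchIn (class b))
    ; sound     = λ eq → back (Fin.punchOut-injective (avoids _) (avoids _) eq)
    ; complete  = λ r → Fin.punchOut-cong (class b) (forth r)
    }

AllPairs-lookup : {xs : List X} → AllPairs E xs →
  ∀ i j → toℕ i < toℕ j → E (List.lookup xs i) (List.lookup xs j)
AllPairs-lookup (s ∷ ss) zero    (suc j) _   = All.lookup s (∈-lookup j)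
AllPairs-lookup (s ∷ ss) (suc i) (suc j) i<j = AllPairs-lookup ss i j (ℕ.≤-pred i<j)

-- Orbits as equivalence classes

module _ {n} (p q : Corner n → Corner n) where

  sameOrbit-isEquivalence : IsEquivalence (SameOrbit p q)
  sameOrbit-isEquivalence = Eq.isEquivalence _

  private
    orbitSetoid : DecSetoid 0ℓ 0ℓ
    orbitSetoid = record
      { Carrier = Corner n
      ; _≈_ = SameOrbit p q
      ; isDecEquivalence = record
        { isEquivalence = sameOrbit-isEquivalence
        ; _≟_ = sameOrbit? p q
        }
      }
    open DecSetoid orbitSetoid using ()
      renaming (setoid to S; trans to ≈-trans; sym to ≈-sym; reflexive to ≈-reflexive)

    reps : List (Corner n)
    reps = List.deduplicate (sameOrbit? p q) (allCorners n)

    member : ∀ c → Any (SameOrbit p q c) reps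
    member c = SetoidMembership.∈-deduplicate⁺ S (sameOrbit? p q) (λ r s → ≈-trans s (≈-sym r))
      (Any.map ≈-reflexive (∈-allCorners c))

    distinct : ∀ i j → SameOrbit p q (List.lookup reps i) (List.lookup reps j) → i ≡ j
    distinct i j r with Fin.<-cmp i j
    ... | tri< i<j _ _ =
      contradiction r (AllPairs-lookup (Unique.deduplicate-! orbitSetoid (allCorners n)) i j i<j)
    ... | tri≈ _ eq _ = eq
    ... | tri> _ _ j<i =
      contradiction (≈-sym r) (AllPairs-lookup (Unique.deduplicate-! orbitSetoid (allCorners n)) j i j<i)

  abstract
    -- Deduplication keeps a representative of every orbit and no two related ones, so indices into
    -- the resulting list serve as labels.
    orbits-classes : HasClasses (SameOrbit p q) (orbits p q)
    orbits-classes = record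
      { class     = λ c → index (member c)
      ; rep       = List.lookup reps
      ; class-rep = λ i → sym (distinct i _ (lookup-index (member (List.lookup reps i))))
      ; sound     = λ {c} {d} eq → SetoidMembership.index-injective S (member c) (member d) eq
      ; complete  = λ {c} {d} r → distinct _ _
          (≈-trans (≈-sym (lookup-index (member c))) (≈-trans r (lookup-index (member d))))
      }

-- Iterates and periods

module _ {X : Set} (g : X → X) where

  iterate-+ : ∀ x k l → iterate g x (k + l) ≡ iterate g (iterate g x k) l
  iterate-+ x zero    l = refl
  iterate-+ x (suc k) l = iterate-+ (g x) k l

  iterate-step : ∀ x k → iterate g (g x) k ≡ g (iterate g x k)
  iterate-step x zero    = refl
  iterate-step x (suc k) = iterate-step (g x) k

  iterate-injective : (∀ {x y} → g x ≡ g y → x ≡ y) → ∀ k {x y} → iterate g x k ≡ iterate g y k → x ≡ y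
  iterate-injective inj zero    eq = eq
  iterate-injective inj (suc k) eq = inj (iterate-injective inj k eq)

  iterate-cancel : (∀ {x y} → g x ≡ g y → x ≡ y) → ∀ {x} i d → iterate g x i ≡ iterate g x (d + i) → x ≡ iterate g x d
  iterate-cancel inj {x} i d eq = iterate-injective inj i (trans eq (iterate-+ x d i))

  iterate-periodic : ∀ {x} p q → iterate g x p ≡ x → iterate g x (q * p) ≡ x
  iterate-periodic     p zero    eq = refl
  iterate-periodic {x} p (suc q) eq = trans (iterate-+ x p (q * p))
    (trans (cong (λ y → iterate g y (q * p)) eq) (iterate-periodic p q eq))

  iterate-% : ∀ {x} p .{{_ : NonZero p}} k → iterate g x p ≡ x → iterate g x (k % p) ≡ iterate g x k
  iterate-% {x} p k eq = sym (begin
    iterate g x k                                  ≡⟨ cong (iterate g x) (trans (m≡m%n+[m/n]*n k p) (ℕ.+-comm (k % p) _)) ⟩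
    iterate g x (k / p * p + k % p)                ≡⟨ iterate-+ x (k / p * p) (k % p) ⟩
    iterate g (iterate g x (k / p * p)) (k % p)    ≡⟨ cong (λ y → iterate g y (k % p)) (iterate-periodic p (k / p) eq) ⟩
    iterate g x (k % p)                            ∎)
    where open ≡-Reasoning

  iterate-cong : ∀ {h : X → X} → (∀ x → g x ≡ h x) → ∀ x k → iterate g x k ≡ iterate h x k
  iterate-cong     eq x zero    = refl
  iterate-cong {h} eq x (suc k) = trans (cong (λ y → iterate g y k) (eq x)) (iterate-cong eq (h x) k)

-- Adding an edge to the edge set

end-involutive : ∀ {n} (c : Corner n) → end (end c) ≡ c
end-involutive (i , h , s) = cong (λ b → i , h , b) (Bool.not-involutive s)

-- The half-turn of each edge-ribbon. It interchanges the two sides of an edge, preserves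
-- orientations, and for antipodal edges is the antipodal map of the circle.
θ : ∀ {n} → Corner n → Corner n
θ (i , h , s) = i , not h , not s

θ-involutive : ∀ {n} (c : Corner n) → θ (θ c) ≡ c
θ-involutive (i , h , s) = cong₂ (λ x y → i , x , y) (Bool.not-involutive h) (Bool.not-involutive s)

record Toggles {n} (x : Fin n) (A A′ : Subset n) : Set where
  field
    keeps : ∀ {y} → y ≢ x → lookup A y ≡ lookup A′ y
    flips : lookup A′ x ≡ not (lookup A x)

toggles-sym : ∀ {n} {x : Fin n} {A A′} → Toggles x A A′ → Toggles x A′ A
toggles-sym T = record
  { keeps = λ y≢x → sym (keeps y≢x)
  ; flips = sym (trans (cong not flips) (Bool.not-involutive _))
  }
  where open Toggles T

-- The boundary components of the spanning ribbon subgraph with edge set A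
-- alternate between ρ A and arcs.
opaque
  ρ : ∀ {n} → Subset n → Corner n → Corner n
  ρ A c = if lookup A (edgeOf c) then side c else end c

module _ {n} (A : Subset n) where
  opaque
    unfolding ρ

    ρ-involutive : ∀ c → ρ A (ρ A c) ≡ c
    ρ-involutive (i , h , s) with lookup A i in eq
    ... | true  rewrite eq = cong (λ x → i , x , s) (Bool.not-involutive h)
    ... | false rewrite eq = cong (λ x → i , h , x) (Bool.not-involutive s)

    ρ-θ : ∀ c → ρ A (θ c) ≡ θ (ρ A c)
    ρ-θ (i , h , s) with lookup A i
    ... | true  = refl
    ... | false = refl

    ρ-∈ : ∀ c → lookup A (edgeOf c) ≡ true → ρ A c ≡ side c
    ρ-∈ c eq rewrite eq = refl

    ρ-∉ : ∀ c → lookup A (edgeOf c) ≡ false → ρ A c ≡ end c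
    ρ-∉ c eq rewrite eq = refl

    -- Describes the four corners of an edge by θ and `ρ A` alone, so that later case distinctions
    -- need not ask whether the edge is in A.
    corner-cases : ∀ c d → edgeOf d ≡ edgeOf c →
      (d ≡ c ⊎ d ≡ θ c) ⊎ (d ≡ ρ A c ⊎ d ≡ ρ A (θ c))
    corner-cases (i , h , s) (.i , h′ , s′) refl with h′ Bool.≟ h | s′ Bool.≟ s
    ... | yes refl | yes refl = inj₁ (inj₁ refl)
    ... | no p | no q = inj₁ (inj₂ (cong₂ (λ x y → i , x , y) (Bool.¬-not p) (Bool.¬-not q)))
    ... | yes refl | no q with lookup A i
    ...   | true  = inj₂ (inj₂ (cong₂ (λ x y → i , x , y) (sym (Bool.not-involutive h)) (Bool.¬-not q)))
    ...   | false = inj₂ (inj₁ (cong (λ y → i , h , y) (Bool.¬-not q)))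
    corner-cases (i , h , s) (.i , h′ , s′) refl | no p | yes refl with lookup A i
    ...   | true  = inj₂ (inj₁ (cong (λ y → i , y , s) (Bool.¬-not p)))
    ...   | false = inj₂ (inj₂ (cong₂ (λ x y → i , x , y) (Bool.¬-not p) (sym (Bool.not-involutive s))))

module _ {n} {x : Fin n} {A A′ : Subset n} (T : Toggles x A A′) where
  open Toggles T

  opaque
    unfolding ρ

    ρ-keeps : ∀ c → edgeOf c ≢ x → ρ A c ≡ ρ A′ c
    ρ-keeps c c≢x = cong (if_then side c else end c) (keeps c≢x)

    -- Toggling exchanges `side` and `end`, and these two differ by the half-turn θ.
    ρ-flips : ∀ c → edgeOf c ≡ x → ρ A′ c ≡ ρ A (θ c)
    ρ-flips (i , h , s) refl rewrite flips with lookup A i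
    ... | true  = cong (λ y → i , y , not s) (sym (Bool.not-involutive h))
    ... | false = cong (λ y → i , not h , y) (sym (Bool.not-involutive s))

-- Boundary walks in an oriented ribbon graph

module Oriented (G : RibbonGraph) (O : Orientable G) where

  n : ℕ
  n = edges G

  α : Corner n → Corner n
  α = arc G

  α-involutive : ∀ c → α (α c) ≡ c
  α-involutive = arc-involutive G

  o : Corner n → Bool
  o = proj₁ O

  o-end : ∀ c → o (end c) ≡ not (o c)
  o-end = proj₁ (proj₂ O)

  o-side : ∀ c → o (side c) ≡ not (o c)
  o-side = proj₁ (proj₂ (proj₂ O))

  o-α : ∀ c → o (α c) ≡ not (o c)
  o-α = proj₂ (proj₂ (proj₂ O))

  o-θ : ∀ c → o (θ c) ≡ o c
  o-θ c = trans (o-end (side c)) (trans (cong not (o-side c)) (Bool.not-involutive (o c)))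

  o-ρ : ∀ A c → o (ρ A c) ≡ not (o c)
  o-ρ A c with lookup A (edgeOf c) in eq
  ... | true  = trans (cong o (ρ-∈ A c eq)) (o-side c)
  ... | false = trans (cong o (ρ-∉ A c eq)) (o-end c)

  -- The two corners of a half-edge are exchanged by `end`, which reverses o.
  half-injective : ∀ c d → o c ≡ o d → edgeOf c ≡ edgeOf d → proj₁ (proj₂ c) ≡ proj₁ (proj₂ d) → c ≡ d
  half-injective (i , h , s) (.i , .h , s′) o≡ refl refl with s Bool.≟ s′
  ... | yes refl = refl
  ... | no s≢s′ = contradiction
    (trans (sym (o-end (i , h , s)))
      (trans (cong (λ t → o (i , h , t)) (sym (Bool.¬-not (s≢s′ ∘ sym)))) (sym o≡)))
    (Bool.not-¬ refl ∘ sym)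

  same-edge : ∀ {c d} → edgeOf d ≡ edgeOf c → o d ≡ o c → d ≡ c ⊎ d ≡ θ c
  same-edge {c@(i , h , s)} {d@(.i , h′ , s′)} refl o≡ with h′ Bool.≟ h
  ... | yes h′≡h = inj₁ (half-injective d c o≡ refl h′≡h)
  ... | no h′≢h  = inj₂ (half-injective d (θ c) (trans o≡ (sym (o-θ c))) refl (Bool.¬-not h′≢h))

  θ-free : ∀ (c : Corner n) → θ c ≢ c
  θ-free (i , h , s) eq = Bool.not-¬ {h} refl (sym (cong (proj₁ ∘ proj₂) eq))

  R : Subset n → Rel (Corner n) 0ℓ
  R A = SameOrbit (ρ A) α

  module R {A : Subset n} = IsEquivalence (sameOrbit-isEquivalence (ρ A) α)

  F : Subset n → ℕ
  F A = orbits (ρ A) α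

  R-α : ∀ {A} c → R A c (α c)
  R-α c = fwd (inj₂ refl) ◅ ε

  R-ρ : ∀ {A} c → R A c (ρ A c)
  R-ρ c = fwd (inj₁ refl) ◅ ε

  -- One step along a boundary component in a fixed direction. As a composite of two maps that
  -- reverse o, it preserves o; each component meets each value of o in a single orbit of `π A`.
  π : Subset n → Corner n → Corner n
  π A c = α (ρ A c)

  R-π : ∀ {A} c → R A c (π A c)
  R-π {A} c = R.trans (R-ρ c) (R-α (ρ A c))

  code : Corner n → Fin (2 * n)
  code (i , h , s) = combine (Inverse.from Fin.2↔Bool h) i

  code-injective : ∀ c d → o c ≡ o d → code c ≡ code d → c ≡ d
  code-injective c@(i , h , s) d@(i′ , h′ , s′) o≡ eq with Fin.combine-injective _ i _ i′ eq
  ... | h≡ , i≡ = half-injective c d o≡ i≡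
    (trans (sym (Inverse.strictlyInverseˡ Fin.2↔Bool h))
      (trans (cong (Inverse.to Fin.2↔Bool) h≡) (Inverse.strictlyInverseˡ Fin.2↔Bool h′)))

  module _ (A : Subset n) where

    π-injective : ∀ {c d} → π A c ≡ π A d → c ≡ d
    π-injective {c} {d} eq = begin
      c                 ≡⟨ ρ-involutive A c ⟨
      ρ A (ρ A c)       ≡⟨ cong (ρ A) (α-involutive _) ⟨
      ρ A (α (π A c))   ≡⟨ cong (ρ A ∘ α) eq ⟩
      ρ A (α (π A d))   ≡⟨ cong (ρ A) (α-involutive _) ⟩
      ρ A (ρ A d)       ≡⟨ ρ-involutive A d ⟩
      d                 ∎
      where open ≡-Reasoning

    o-π : ∀ c → o (π A c) ≡ o c
    o-π c = trans (o-α (ρ A c)) (trans (cong not (o-ρ A c)) (Bool.not-involutive (o c)))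

    o-iterate : ∀ c k → o (iterate (π A) c k) ≡ o c
    o-iterate c zero    = refl
    o-iterate c (suc k) = trans (o-iterate (π A c) k) (o-π c)

    abstract
      -- Pigeonhole: the walk stays among corners with the same value of o, which `code` embeds into
      -- the 2n half-edges. Injectivity of `π A` moves the first coincidence back to the start.
      period : ∀ c → ∃[ p ] p < 2 * n × iterate (π A) c (suc p) ≡ c
      period c with Fin.pigeonhole (ℕ.n<1+n (2 * n)) (code ∘ iterate (π A) c ∘ toℕ)
      ... | i , j , i<j , eq with ℕ.m≤n⇒∃[o]m+o≡n i<j
      ...   | p , i+p≡j = p , ℕ.≤-trans (s≤s (ℕ.m≤n+m p (toℕ i))) (ℕ.≤-trans (ℕ.≤-reflexive i+p≡j) (Fin.toℕ≤pred[n] j)) ,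
        sym (iterate-cancel (π A) π-injective (toℕ i) (suc p)
          (trans (code-injective _ _ (trans (o-iterate c (toℕ i)) (sym (o-iterate c (toℕ j)))) eq)
                 (cong (iterate (π A) c) (trans (sym i+p≡j) (cong suc (ℕ.+-comm (toℕ i) p))))))

    private
      Reaches : Corner n → Corner n → Set
      Reaches d c = ∃[ k ] iterate (π A) c k ≡ d

      -- `ρ A (α c)` is the predecessor of c; by periodicity the walk from c comes round to it.
      back : ∀ {d} c → Reaches d (ρ A (α c)) → Reaches d c
      back {d} c (k , eq) with period (ρ A (α c))
      ... | p , _ , per = p + k , (begin
        iterate (π A) c (p + k)                        ≡⟨ cong (λ x → iterate (π A) x (p + k)) c≡ ⟩
        iterate (π A) (ρ A (α c)) (suc (p + k))        ≡⟨ iterate-+ (π A) (ρ A (α c)) (suc p) k ⟩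
        iterate (π A) (iterate (π A) (ρ A (α c)) (suc p)) k ≡⟨ cong (λ x → iterate (π A) x k) per ⟩
        iterate (π A) (ρ A (α c)) k                    ≡⟨ eq ⟩
        d                                              ∎)
        where
        open ≡-Reasoning
        c≡ : c ≡ π A (ρ A (α c))
        c≡ = sym (trans (cong α (ρ-involutive A (α c))) (α-involutive c))

      -- The invariant for induction along a chain of relations: since walks preserve o, a corner
      -- with the wrong value of o is first replaced by its `ρ A` partner.
      Follows : Corner n → Corner n → Set
      Follows d c = (o c ≡ o d → Reaches d c) × (o c ≢ o d → Reaches d (ρ A c))

      follows-ρ : ∀ {d} c → Follows d (ρ A c) → Follows d c
      follows-ρ {d} c (p , q) =
        (λ eq → subst (Reaches d) (ρ-involutive A c) (q λ eq′ → Bool.not-¬ refl (trans eq (trans (sym eq′) (o-ρ A c))))) ,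
        (λ neq → p (trans (o-ρ A c) (sym (Bool.¬-not (neq ∘ sym)))))

      follows-α : ∀ {d} c → Follows d (α c) → Follows d c
      follows-α {d} c (p , q) =
        (λ eq → back c (q λ eq′ → Bool.not-¬ refl (trans eq (trans (sym eq′) (o-α c))))) ,
        (λ neq → forth (p (trans (o-α c) (sym (Bool.¬-not (neq ∘ sym))))))
        where
        forth : Reaches d (α c) → Reaches d (ρ A c)
        forth (k , eq) = suc k , trans (cong (λ x → iterate (π A) (α x) k) (ρ-involutive A c)) eq

      follows : ∀ {c d} → R A c d → Follows d c
      follows ε = (λ _ → 0 , refl) , contradiction refl
      follows {c} (fwd (inj₁ refl) ◅ r) = follows-ρ c (follows r)
      follows {c} (fwd (inj₂ refl) ◅ r) = follows-α c (follows r)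
      follows (_◅_ {j = c′} (bwd (inj₁ refl)) r) =
        follows-ρ _ (subst (Follows _) (sym (ρ-involutive A c′)) (follows r))
      follows (_◅_ {j = c′} (bwd (inj₂ refl)) r) =
        follows-α _ (subst (Follows _) (sym (α-involutive c′)) (follows r))

    reach : ∀ {c d} → R A c d → o c ≡ o d → ∃[ k ] iterate (π A) c k ≡ d
    reach r = proj₁ (follows r)

  -- A trace of the walk up to its first corner on x. Since no step of it crosses x, it does not
  -- depend on whether x belongs to A.
  data Hits (A : Subset n) (x : Fin n) : Corner n → Corner n → Set where
    stop : ∀ {h} → edgeOf h ≡ x → Hits A x h h
    step : ∀ {c h} → edgeOf c ≢ x → Hits A x (π A c) h → Hits A x c h

  hits-edge : ∀ {A x c h} → Hits A x c h → edgeOf h ≡ x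
  hits-edge (stop eq)  = eq
  hits-edge (step _ H) = hits-edge H

  hits-o : ∀ {A x c h} → Hits A x c h → o h ≡ o c
  hits-o (stop _)               = refl
  hits-o {A} {c = c} (step _ H) = trans (hits-o H) (o-π A c)

  hits-R : ∀ {A x c h} → Hits A x c h → R A c h
  hits-R (stop _)   = R.refl
  hits-R (step _ H) = R.trans (R-π _) (hits-R H)

  hits-exists : ∀ A x k c → edgeOf (iterate (π A) c k) ≡ x → ∃[ h ] Hits A x c h
  hits-exists A x zero    c eq = c , stop eq
  hits-exists A x (suc k) c eq with edgeOf c Fin.≟ x
  ... | yes c≡x = c , stop c≡x
  ... | no c≢x  = map₂ (step c≢x) (hits-exists A x k (π A c) eq)

  hits-toggle : ∀ {A A′ x c h} → Toggles x A A′ → Hits A x c h → Hits A′ x c h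
  hits-toggle T (stop eq) = stop eq
  hits-toggle {A′ = A′} {x} {c} {h} T (step c≢x H) =
    step c≢x (subst (λ d → Hits A′ x d h) (cong α (ρ-keeps T c c≢x)) (hits-toggle T H))

  module _ {A : Subset n} where

    -- Periodicity guarantees a return to the edge, and only c and `θ c` have the right value of o
    -- there. The first outcome means that the sides of the edge lie on different components, the
    -- second that they share one.
    first-hit : ∀ c → Hits A (edgeOf c) (π A c) c ⊎ Hits A (edgeOf c) (π A c) (θ c)
    first-hit c with period A c
    ... | p , _ , eq with hits-exists A (edgeOf c) p (π A c) (cong edgeOf eq)
    ...   | h , H with same-edge {c} {h} (hits-edge H) (trans (hits-o H) (o-π A c))
    ...     | inj₁ refl = inj₁ H
    ...     | inj₂ refl = inj₂ H

    -- If the boundary component through c comes back to the edge at c itself,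
    -- it never passes through θ c.
    module _ {c : Corner n} (closed : Hits A (edgeOf c) (π A c) c) where

      closed-step : ∀ {d} → Hits A (edgeOf c) d c → Hits A (edgeOf c) (π A d) c
      closed-step (stop _)   = closed
      closed-step (step _ H) = H

      closed-avoids : ∀ d k → Hits A (edgeOf c) d c → iterate (π A) d k ≢ θ c
      -- Invariant of the walk: the next corner met on this edge is c.
      closed-avoids d (suc k) H eq = closed-avoids (π A d) k (closed-step H) eq
      closed-avoids d zero H refl with θ c in eq
      closed-avoids d zero (stop _) refl     | _ = θ-free c eq
      closed-avoids d zero (step d≢c _) refl | _ = d≢c (cong edgeOf (sym eq))

      closed-separates : ¬ R A c (θ c)
      closed-separates r with reach A r (sym (o-θ c))
      ... | k , eq = closed-avoids c k (stop refl) eq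

      -- Were c the first return from `θ c`, the walk would continue along the component of c and
      -- yet close up at `θ c`.
      closed-opposite : Hits A (edgeOf c) (π A (θ c)) (θ c)
      closed-opposite with first-hit (θ c)
      ... | inj₁ H = H
      ... | inj₂ H with period A (θ c)
      ...   | p , _ , eq = contradiction eq
        (closed-avoids _ p (subst (Hits A (edgeOf c) (π A (θ c))) (θ-involutive c) H))

  module _ {A A′ : Subset n} {c : Corner n} (T : Toggles (edgeOf c) A A′)
           (closed : Hits A (edgeOf c) (π A c) c) where

    private
      -- The old component cut open at the edge: its remaining path does not cross the edge and
      -- hence survives the toggle.
      loop : R A′ (ρ A c) c
      loop = R.trans (R-α _) (hits-R (hits-toggle T closed))

      loop-θ : R A′ (ρ A (θ c)) (θ c)
      loop-θ = R.trans (R-α _) (hits-R (hits-toggle T (closed-opposite closed)))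

      joins : R A′ c (θ c)
      joins = R.trans (R-ρ c) (subst (λ d → R A′ d (θ c)) (sym (ρ-flips T c refl)) loop-θ)

      extend-ρ : ∀ d → R A′ d (ρ A d)
      extend-ρ d with edgeOf d Fin.≟ edgeOf c
      ... | no d≢c = subst (R A′ d) (sym (ρ-keeps T d d≢c)) (R-ρ d)
      ... | yes d≡c with corner-cases A c d d≡c
      ...   | inj₁ (inj₁ refl) = R.sym loop
      ...   | inj₁ (inj₂ refl) = R.sym loop-θ
      ...   | inj₂ (inj₁ refl) = subst (R A′ (ρ A c)) (sym (ρ-involutive A c)) loop
      ...   | inj₂ (inj₂ refl) = subst (R A′ (ρ A (θ c))) (sym (ρ-involutive A (θ c))) loop-θ

      classes : HasClasses (R A) (F A)
      classes = orbits-classes (ρ A) α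

      merged : Corner n → Fin (F A)
      merged = redirect classes c (θ c)

      merged-R : ∀ {x y} → R A x y → merged x ≡ merged y
      merged-R = redirect-complete classes c (θ c)

      merged-joins : merged c ≡ merged (θ c)
      merged-joins = redirect-joins classes c (θ c)

      flip-θ : ρ A′ (θ c) ≡ ρ A c
      flip-θ = trans (ρ-flips T (θ c) refl) (cong (ρ A) (θ-involutive c))

      swap : ∀ d d′ → ρ A′ d ≡ d′ → ρ A′ d′ ≡ d
      swap d _ refl = ρ-involutive A′ d

      -- At the toggled edge `ρ A′` crosses from the component of c to that of `θ c` or back, and
      -- `merged` identifies these; at other edges it agrees with `ρ A`.
      merged-ρ : ∀ d → merged d ≡ merged (ρ A′ d)
      merged-ρ d with edgeOf d Fin.≟ edgeOf c
      ... | no d≢c = merged-R (subst (R A d) (ρ-keeps T d d≢c) (R-ρ d))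
      ... | yes d≡c with corner-cases A c d d≡c
      ...   | inj₁ (inj₁ refl) =
        trans merged-joins (trans (merged-R (R-ρ (θ c))) (cong merged (sym (ρ-flips T c refl))))
      ...   | inj₁ (inj₂ refl) =
        trans (sym merged-joins) (trans (merged-R (R-ρ c)) (cong merged (sym flip-θ)))
      ...   | inj₂ (inj₁ refl) = trans (merged-R (R.sym (R-ρ c)))
        (trans merged-joins (cong merged (sym (swap (θ c) (ρ A c) flip-θ))))
      ...   | inj₂ (inj₂ refl) = trans (merged-R (R.sym (R-ρ (θ c))))
        (trans (sym merged-joins) (cong merged (sym (swap c (ρ A (θ c)) (ρ-flips T c refl)))))

    closed-merges : Merges (R A) (R A′) c (θ c)
    closed-merges = record
      { extends = Eq.fold (sameOrbit-isEquivalence (ρ A′) α)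
          (λ { (inj₁ refl) → extend-ρ _ ; (inj₂ refl) → R-α _ })
      ; joins   = joins
      -- `merged` is constant along both generators of `R A′`, so it is constant on its classes.
      ; only    = λ r → redirect-only classes c (θ c)
          (Eq.gfold isEquivalence merged
            (λ { (inj₁ refl) → merged-ρ _ ; (inj₂ refl) → merged-R (R-α _) }) r)
      }

  -- Whether the two sides of the edge at c belong to the same vertex of the
  -- partial dual with respect to A.
  Joined : Subset n → Corner n → Set
  Joined A c = R A c (θ c)

  record Splits (A A′ : Subset n) (c : Corner n) : Set where
    field
      apart  : ¬ Joined A c
      merges : Merges (R A) (R A′) c (θ c)

    together : Joined A′ c
    together = Merges.joins merges

    one-more : F A ≡ suc (F A′)
    one-more = classes-merge (sameOrbit-isEquivalence (ρ A′) α) merges apart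
      (orbits-classes (ρ A) α) (orbits-classes (ρ A′) α)

  -- Of the two outcomes of `first-hit`, the second turns into the first after the toggle: the new
  -- walk leaves c as the old one left `θ c`, and that one returns at c.
  toggle-splits : ∀ {A A′} c → Toggles (edgeOf c) A A′ → Splits A A′ c ⊎ Splits A′ A c
  toggle-splits {A} {A′} c T with first-hit {A} c
  ... | inj₁ H = inj₁ record { apart = closed-separates H ; merges = closed-merges T H }
  ... | inj₂ H = inj₂ record { apart = closed-separates H′ ; merges = closed-merges (toggles-sym T) H′ }
    where
    H-θ : Hits A (edgeOf c) (π A (θ c)) c
    H-θ with first-hit {A} (θ c)
    -- If `θ c` returned to itself, the walk from c, once at `θ c`, could never close up at c.
    ... | inj₁ H″ = contradiction (trans (proj₂ (proj₂ (period A c))) (sym (θ-involutive c)))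
      (closed-avoids {c = θ c} H″ _ (proj₁ (period A c)) H)
    ... | inj₂ H″ = subst (Hits A (edgeOf c) (π A (θ c))) (θ-involutive c) H″
    H′ : Hits A′ (edgeOf c) (π A′ c) c
    H′ = subst (λ d → Hits A′ (edgeOf c) (α d) c) (sym (ρ-flips T c refl)) (hits-toggle T H-θ)

-- Partial duals and the polynomial

length-subsets : ∀ n → List.length (subsets n) ≡ 2 ^ n
length-subsets zero    = refl
length-subsets (suc n) = begin
  List.length (subsets (suc n))                 ≡⟨ List.length-++ (List.map (false ∷_) (subsets n)) ⟩
  List.length (List.map (false ∷_) (subsets n)) + List.length (List.map (true ∷_) (subsets n))
    ≡⟨ cong₂ _+_ (List.length-map _ (subsets n)) (List.length-map _ (subsets n)) ⟩
  List.length (subsets n) + List.length (subsets n)  ≡⟨ cong₂ _+_ (length-subsets n) (length-subsets n) ⟩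
  2 ^ n + 2 ^ n                            ≡⟨ cong (λ k → 2 ^ n + k) (ℕ.+-identityʳ (2 ^ n)) ⟨
  2 ^ suc n                                ∎
  where open ≡-Reasoning

∈-subsets : ∀ {n} (A : Subset n) → A ∈ subsets n
∈-subsets []                  = here refl
∈-subsets (false ∷ A)         = ∈-++⁺ˡ (∈-map⁺ (false ∷_) (∈-subsets A))
∈-subsets {suc n} (true ∷ A)  = ∈-++⁺ʳ (List.map (false ∷_) (subsets n)) (∈-map⁺ (true ∷_) (∈-subsets A))

module _ {X : Set} (g : X → ℤ) where

  private
    Σz^ : List X → Poly
    Σz^ xs = List.foldr _⊕_ 0ᵖ (List.map (λ x → z^ g x) xs)

    z^-≤1 : ∀ m k → (z^ m) k ≤ 1
    z^-≤1 m k with k ℤ.≟ m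
    ... | yes _ = s≤s z≤n
    ... | no _  = z≤n

    z^-1 : ∀ m k → (z^ m) k ≡ 1 → k ≡ m
    z^-1 m k eq with k ℤ.≟ m
    ... | yes k≡m = k≡m

    z^-refl : ∀ m → (z^ m) m ≡ 1
    z^-refl m with m ℤ.≟ m
    ... | yes _  = refl
    ... | no m≢m = contradiction refl m≢m

    Σ-≤ : ∀ xs k → Σz^ xs k ≤ List.length xs
    Σ-≤ []       k = z≤n
    Σ-≤ (x ∷ xs) k = ℕ.+-mono-≤ (z^-≤1 (g x) k) (Σ-≤ xs k)

    -- Each term contributes at most 1 to a coefficient, so a coefficient equal to the number of
    -- terms takes 1 from every one of them.
    Σ-maximal : ∀ xs k → Σz^ xs k ≡ List.length xs → ∀ {x} → x ∈ xs → g x ≡ k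
    Σ-maximal (x ∷ xs) k eq m = go m
      where
      first : (z^ g x) k ≡ 1
      first = ℕ.≤-antisym (z^-≤1 (g x) k) (ℕ.+-cancelʳ-≤ (List.length xs) 1 _
        (ℕ.≤-trans (ℕ.≤-reflexive (sym eq)) (ℕ.+-monoʳ-≤ ((z^ g x) k) (Σ-≤ xs k))))
      go : ∀ {y} → y ∈ x ∷ xs → g y ≡ k
      go (here refl) = sym (z^-1 (g x) k first)
      go (there m′)  = Σ-maximal xs k
        (ℕ.+-cancelˡ-≡ 1 _ _ (trans (cong (_+ Σz^ xs k) (sym first)) eq)) m′

  monomial⇒constant : ∀ xs {N m} → List.length xs ≡ N → Σz^ xs ≈ N · z^ m → ∀ {x} → x ∈ xs → g x ≡ m
  monomial⇒constant xs {m = m} refl eq = Σ-maximal xs m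
    (trans (eq m) (trans (cong (List.length xs *_) (z^-refl m)) (ℕ.*-identityʳ (List.length xs))))

  constant⇒monomial : ∀ xs {N m} → List.length xs ≡ N → (∀ x → g x ≡ m) → Σz^ xs ≈ N · z^ m
  constant⇒monomial []       refl eq k = refl
  constant⇒monomial (x ∷ xs) refl eq k =
    cong₂ _+_ (cong (λ m → (z^ m) k) (eq x)) (constant⇒monomial xs refl eq k)

toggles-∁ : ∀ {n} {x : Fin n} {A A′} → Toggles x A A′ → Toggles x (∁ A) (∁ A′)
toggles-∁ {x = x} {A} {A′} T = record
  { keeps = λ {y} y≢x → trans (Vec.lookup-map y not A)
      (trans (cong not (keeps y≢x)) (sym (Vec.lookup-map y not A′)))
  ; flips = trans (Vec.lookup-map x not A′)
      (trans (cong not flips) (cong not (sym (Vec.lookup-map x not A))))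
  }
  where open Toggles T

toggle : ∀ {n} → Fin n → Subset n → Subset n
toggle x A = updateAt A x not

toggles-toggle : ∀ {n} (x : Fin n) A → Toggles x A (toggle x A)
toggles-toggle x A = record
  { keeps = λ y≢x → sym (Vec.lookup∘updateAt′ _ x y≢x A)
  ; flips = Vec.lookup∘updateAt x A
  }

toggles-∷ : ∀ {n b} {x : Fin n} {A A′} → Toggles x A A′ → Toggles (suc x) (b ∷ A) (b ∷ A′)
toggles-∷ T = record
  { keeps = λ { {zero} _ → refl ; {suc y} y≢x → keeps (y≢x ∘ cong suc) }
  ; flips = flips
  }
  where open Toggles T

toggles-head : ∀ {n b} {A : Subset n} → Toggles zero (b ∷ A) (not b ∷ A)
toggles-head = record
  { keeps = λ { {zero} 0≢0 → contradiction refl 0≢0 ; {suc y} _ → refl }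
  ; flips = refl
  }

-- Passing to the complement toggles each of the n edges once, and every toggle changes the parity.
complement-parity : ∀ {n} (g : Subset n → Parity) →
  (∀ {x A A′} → Toggles x A A′ → g A′ ≡ g A ⁻¹) →
  ∀ A → g A +ℙ g (∁ A) ≡ parity n
complement-parity g flip [] = Parity.p+p≡0ℙ (g [])
complement-parity {suc n} g flip (b ∷ A) = begin
  g (b ∷ A) +ℙ g (not b ∷ ∁ A)     ≡⟨ cong (g (b ∷ A) +ℙ_) (flip toggles-head) ⟩
  g (b ∷ A) +ℙ g (b ∷ ∁ A) ⁻¹      ≡⟨ +-⁻¹ (g (b ∷ A)) (g (b ∷ ∁ A)) ⟩
  (g (b ∷ A) +ℙ g (b ∷ ∁ A)) ⁻¹    ≡⟨ cong _⁻¹ (complement-parity (g ∘ (b ∷_)) (flip ∘ toggles-∷) A) ⟩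
  parity n ⁻¹                      ≡⟨ cong _⁻¹ (Parity.suc-homo-⁻¹ n) ⟨
  (parity (suc n) ⁻¹) ⁻¹           ≡⟨ Parity.⁻¹-involutive _ ⟩
  parity (suc n)                   ∎
  where
  open ≡-Reasoning
  +-⁻¹ : ∀ p q → p +ℙ q ⁻¹ ≡ (p +ℙ q) ⁻¹
  +-⁻¹ 0ℙ q = refl
  +-⁻¹ 1ℙ q = refl

parity-odd : ∀ n → parity n ≡ 1ℙ → ∃[ i ] n ≡ 2 * i + 1
parity-odd (suc zero)    _  = 0 , refl
parity-odd (suc (suc n)) eq with parity-odd n eq
... | i , refl = suc i , cong (_+ 1) (sym (ℕ.*-suc 2 i))

odd-parity : ∀ i → parity (2 * i + 1) ≡ 1ℙ
odd-parity zero    = refl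
odd-parity (suc i) = trans (cong (λ m → parity (m + 1)) (ℕ.*-suc 2 i)) (odd-parity i)

module Bouquets (G : RibbonGraph) (O : Orientable G) (bouquet : Bouquet G) (nonempty : 1 ≤ e G) where
  open Oriented G O public

  c₀ : Corner n
  c₀ = fromℕ< nonempty , false , false

  private
    -- The corner `c₀` already accounts for one orbit, which leaves no room for an isolated
    -- vertex-disc.
    one-orbit : orbits end α ≡ 1 × isolated G ≡ 0
    one-orbit = unit (HasClasses.class (orbits-classes end α) c₀) bouquet
      where
      unit : ∀ {a b} → Fin a → a + b ≡ 1 → a ≡ 1 × b ≡ 0
      unit {suc zero} {zero} _ _ = refl , refl

  isolated-0 : isolated G ≡ 0
  isolated-0 = proj₂ one-orbit

  ρ-⊥ : ∀ (c : Corner n) → ρ ⊥ c ≡ end c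
  ρ-⊥ c = ρ-∉ ⊥ c (Vec.lookup-replicate (edgeOf c) false)

  R-⊥ : ∀ (c d : Corner n) → R ⊥ c d
  R-⊥ c d = Eq.map
    (λ { (inj₁ refl) → inj₁ (ρ-⊥ _) ; (inj₂ refl) → inj₂ refl })
    (HasClasses.sound (subst (HasClasses (SameOrbit end α)) (proj₁ one-orbit) (orbits-classes end α)) (Fin1 _ _))
    where
    Fin1 : (i j : Fin 1) → i ≡ j
    Fin1 zero zero = refl

  F-⊥ : F ⊥ ≡ 1
  F-⊥ = classes-unique (orbits-classes (ρ ⊥) α) record
    { class     = λ _ → zero
    ; rep       = λ _ → c₀
    ; class-rep = λ { zero → refl }
    ; sound     = λ _ → R-⊥ _ _
    ; complete  = λ _ → refl
    }

  exchange-end : ∀ A (c : Corner n) → exchange A (end c) ≡ ρ A (exchange A c)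
  exchange-end A (i , h , s) with lookup A i in eq
  ... | true  = sym (ρ-∈ A (i , s , h) eq)
  ... | false = sym (ρ-∉ A (i , h , s) eq)

  exchange-side : ∀ A (c : Corner n) → exchange A (side c) ≡ ρ (∁ A) (exchange A c)
  exchange-side A (i , h , s) with lookup A i in eq
  ... | true  = sym (ρ-∉ (∁ A) (i , s , h) (trans (Vec.lookup-map i not A) (cong not eq)))
  ... | false = sym (ρ-∈ (∁ A) (i , h , s) (trans (Vec.lookup-map i not A) (cong not eq)))

  -- Renaming by `exchange A` turns `end` into `ρ A` and `side` into `ρ (∁ A)`; thus F counts the
  -- vertices of the partial dual at A and its boundary components at `∁ A`.
  orbits-partialDual : ∀ A B (r : Corner n → Corner n) →
    (∀ c → exchange A (r c) ≡ ρ B (exchange A c)) →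
    orbits r (arc (partialDual G A)) ≡ F B
  orbits-partialDual A B r r≗ρ = classes-unique (orbits-classes r _)
    (classes-transfer x x xx forth (λ {c} {d} → back {c} {d}) (orbits-classes (ρ B) α))
    where
    x : Corner n → Corner n
    x = exchange A
    xx : ∀ c → x (x c) ≡ c
    xx = exchange-involutive A
    forth : ∀ {c d} → SameOrbit r (conjugate x α) c d → R B (x c) (x d)
    forth = Eq.gmap x λ
      { (inj₁ refl) → inj₁ (sym (r≗ρ _))
      ; (inj₂ refl) → inj₂ (sym (xx _)) }
    back : ∀ {c d} → R B (x c) (x d) → SameOrbit r (conjugate x α) c d
    back {c} {d} p = subst₂ (SameOrbit r (conjugate x α)) (xx c) (xx d) (Eq.gmap x (λ
      { {c} (inj₁ refl) → inj₁ (trans (sym (xx _)) (cong x (trans (r≗ρ _) (cong (ρ B) (xx c)))))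
      ; {c} (inj₂ refl) → inj₂ (cong (x ∘ α) (xx c)) }) p)

  genus : ∀ A → eulerGenus (partialDual G A) ≡ + (2 + n) - + (F A + F (∁ A))
  genus A = begin
    eulerGenus (partialDual G A)
      ≡⟨ cong₂ (λ a b → + 2 - ((+ a - + n) +ℤ + b))
           (vertices (orbits-partialDual A A end (exchange-end A)))
           (vertices (orbits-partialDual A (∁ A) side (exchange-side A))) ⟩
    + 2 - ((+ F A - + n) +ℤ + F (∁ A))   ≡⟨ rearrange (+ F A) (+ n) (+ F (∁ A)) ⟩
    + (2 + n) - + (F A + F (∁ A))        ∎
    where
    open ≡-Reasoning
    vertices : ∀ {a b} → a ≡ b → a + isolated G ≡ b
    vertices {a} refl = trans (cong (λ k → a + k) isolated-0) (ℕ.+-identityʳ a)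
    rearrange : ∀ a m b → + 2 - ((a - m) +ℤ b) ≡ (+ 2 +ℤ m) - (a +ℤ b)
    rearrange = solve 3 (λ a m b → con (+ 2) :- ((a :- m) :+ b) := (con (+ 2) :+ m) :- (a :+ b)) refl
      where open +-*-Solver

  F-parity : ∀ A → parity (F A) +ℙ parity (F (∁ A)) ≡ parity n
  F-parity = complement-parity (parity ∘ F) flip
    where
    flip : ∀ {x A A′} → Toggles x A A′ → parity (F A′) ≡ parity (F A) ⁻¹
    flip {x} {A} {A′} T with toggle-splits (x , false , false) T
    ... | inj₁ Sp = sym (trans (cong (λ k → parity k ⁻¹) (Splits.one-more Sp)) (Parity.suc-homo-⁻¹ (F A′)))
    ... | inj₂ Sp = trans (cong parity (Splits.one-more Sp))
      (trans (sym (Parity.⁻¹-involutive _)) (cong _⁻¹ (Parity.suc-homo-⁻¹ (F A))))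

-- Positions on the boundary circle of the vertex

module Circle (G : RibbonGraph) (O : Orientable G) (bouquet : Bouquet G) (nonempty : 1 ≤ e G) where
  open Bouquets G O bouquet nonempty public

  -- The walk around the vertex, written with `π ⊥` so that the results on boundary walks apply.
  W : Corner n → ℕ → Corner n
  W = iterate (π ⊥)

  W-+ : ∀ c k l → W c (k + l) ≡ W (W c k) l
  W-+ = iterate-+ (π ⊥)

  o-W : ∀ c k → o (W c k) ≡ o c
  o-W = o-iterate ⊥

  W≡walk : ∀ c k → W c k ≡ walk G c k
  W≡walk = iterate-cong (π ⊥) (cong α ∘ ρ-⊥)

  reach-below : ∀ {c} p → W c (suc p) ≡ c → ∀ d → o c ≡ o d → ∃[ k ] k < suc p × W c k ≡ d
  reach-below {c} p per d o≡ with reach ⊥ (R-⊥ c d) o≡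
  ... | k , eq = k % suc p , m%n<n k (suc p) , trans (iterate-% (π ⊥) (suc p) k per) eq

  private
    -- The corner of the half-edge (i, h) at which o has the value b.
    sideTowards : Bool → Fin n → Bool → Corner n
    sideTowards b i h = if agrees then (i , h , false) else (i , h , true)
      where
      agrees : Bool
      agrees = not (b xor o (i , h , false))

    sideTowards-o : ∀ b i h → o (sideTowards b i h) ≡ b
    sideTowards-o b i h with o (i , h , false) in eq | o-end (i , h , false)
    sideTowards-o true  i h | true  | _ = eq
    sideTowards-o false i h | false | _ = eq
    sideTowards-o true  i h | false | eq′ = eq′
    sideTowards-o false i h | true  | eq′ = eq′

    sideTowards-code : ∀ b i h → code (sideTowards b i h) ≡ combine (Inverse.from Fin.2↔Bool h) i
    sideTowards-code b i h with not (b xor o (i , h , false))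
    ... | true  = refl
    ... | false = refl

  -- Each of the 2n half-edges has a corner with the same value of o as c, and all these corners are
  -- met within one period.
  period-≥ : ∀ c p → W c (suc p) ≡ c → 2 * n ≤ suc p
  period-≥ c p per = Fin.injective⇒≤ {f = position} injective
    where
    corner′ : Fin (2 * n) → Corner n
    corner′ i = sideTowards (o c) (proj₂ (remQuot {2} n i)) (Inverse.to Fin.2↔Bool (proj₁ (remQuot {2} n i)))
    found : ∀ i → ∃[ k ] k < suc p × W c k ≡ corner′ i
    found i = reach-below p per (corner′ i) (sym (sideTowards-o (o c) _ _))
    position : Fin (2 * n) → Fin (suc p)
    position i = fromℕ< (proj₁ (proj₂ (found i)))
    code-corner : ∀ i → code (corner′ i) ≡ i
    code-corner i = trans (sideTowards-code (o c) _ _)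
      (trans (cong (λ j → combine j (proj₂ (remQuot {2} n i))) (Inverse.strictlyInverseʳ Fin.2↔Bool (proj₁ (remQuot {2} n i))))
             (Fin.combine-remQuot {2} n i))
    injective : ∀ {i j} → position i ≡ position j → i ≡ j
    injective {i} {j} eq = trans (sym (code-corner i)) (trans (cong code (begin
      corner′ i             ≡⟨ proj₂ (proj₂ (found i)) ⟨
      W c (proj₁ (found i)) ≡⟨ cong (W c) (Fin.fromℕ<-injective _ _ _ _ eq) ⟩
      W c (proj₁ (found j)) ≡⟨ proj₂ (proj₂ (found j)) ⟩
      corner′ j             ∎)) (code-corner j))
      where open ≡-Reasoning

  W-full : ∀ c → W c (2 * n) ≡ c
  W-full c with period ⊥ c
  ... | p , p<2n , per = trans (cong (W c) (ℕ.≤-antisym (period-≥ c p per) p<2n)) per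

  abstract
    reach-2n : ∀ c d → o c ≡ o d → ∃[ k ] k < 2 * n × W c k ≡ d
    reach-2n c d o≡ with period ⊥ c
    ... | p , p<2n , per with reach-below p per d o≡
    ...   | k , k<p , eq = k , ℕ.≤-trans k<p p<2n , eq

  W-< : ∀ c {i j} → i < j → j < 2 * n → W c i ≢ W c j
  W-< c {i} {j} i<j j<2n eq with ℕ.m≤n⇒∃[o]m+o≡n i<j
  ... | d , refl = ℕ.<⇒≱ j<2n (ℕ.≤-trans
    (period-≥ c d (sym (iterate-cancel (π ⊥) (π-injective ⊥) i (suc d)
      (trans eq (cong (W c) (cong suc (ℕ.+-comm i d)))))))
    (s≤s (ℕ.m≤n+m d i)))

  W-injective : ∀ c {i j} → i < 2 * n → j < 2 * n → W c i ≡ W c j → i ≡ j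
  W-injective c {i} {j} i< j< eq with ℕ.<-cmp i j
  ... | tri< i<j _ _ = contradiction eq (W-< c i<j j<)
  ... | tri≈ _ i≡j _ = i≡j
  ... | tri> _ _ j<i = contradiction (sym eq) (W-< c j<i i<)

  W-return : ∀ c {i j} → i < j → j < 2 * n → edgeOf (W c i) ≡ edgeOf (W c j) → W c j ≡ θ (W c i)
  W-return c {i} {j} i<j j<2n eq with same-edge {W c i} {W c j} (sym eq) (trans (o-W c j) (sym (o-W c i)))
  ... | inj₁ eq′ = contradiction (sym eq′) (W-< c i<j j<2n)
  ... | inj₂ eq′ = eq′

  single : Fin n → Subset n
  single x = toggle x ⊥

  -- As long as the walk does not meet x, the maps `ρ ⊥` and `ρ (single x)` agree along it.
  segment : ∀ x c k → (∀ i → i < k → edgeOf (W c i) ≢ x) → R (single x) c (W c k)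
  segment x c zero    avoids = R.refl
  segment x c (suc k) avoids = R.trans
    (subst (R (single x) c) (cong α (sym (ρ-keeps (toggles-toggle x ⊥) c (avoids 0 z<s)))) (R-π c))
    (segment x (π ⊥ c) k (λ i i<k → avoids (suc i) (s<s i<k)))

  segment′ : ∀ x c i j → i ≤ j → (∀ k → i ≤ k → k < j → edgeOf (W c k) ≢ x) → R (single x) (W c i) (W c j)
  segment′ x c i j i≤j avoids with ℕ.m≤n⇒∃[o]m+o≡n i≤j
  ... | d , refl = subst (R (single x) (W c i)) (sym (W-+ c i d))
    (segment x (W c i) d λ k k<d eq → avoids (i + k) (ℕ.m≤m+n i k) (ℕ.+-monoʳ-< i k<d)
      (trans (cong edgeOf (W-+ c i k)) eq))

  -- For ⊥ there is one component only, so adding the edge can only separate its sides.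
  single-apart : ∀ c → ¬ Joined (single (edgeOf c)) c
  single-apart c with toggle-splits c (toggles-toggle (edgeOf c) ⊥)
  ... | inj₁ Sp = contradiction (R-⊥ c (θ c)) (Splits.apart Sp)
  ... | inj₂ Sp = Splits.apart Sp

  -- The ends of y lie in different pieces of the circle cut open at the ends of x.
  interlaced-apart : ∀ {x y} → Interlaced G x y → ∃[ d ] edgeOf d ≡ y × ¬ Joined (single x) d
  interlaced-apart {x} {y} (x≢y , c , i , j , k , (0<i , i<j , j<k , k<2n) , refl , ei , ej , ek) =
    -- One piece leads from the first end of y to `θ c`, the other from the second end of y round to
    -- c. If the sides of y were together, so would be those of x.
    W c i , at i ei , λ s → single-apart c (R.trans (R.sym wrap) (R.trans (R.sym
      (subst (R (single x) (W c i)) Wk s)) (subst (R (single x) (W c i)) Wj first)))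
    where
    at : ∀ i {z} → edgeOf (walk G c i) ≡ z → edgeOf (W c i) ≡ z
    at i eq = trans (cong edgeOf (W≡walk c i)) eq
    j<2n = ℕ.<-trans j<k k<2n
    Wj : W c j ≡ θ c
    Wj = W-return c (ℕ.<-trans 0<i i<j) j<2n (sym (at j ej))
    Wk : θ (W c i) ≡ W c k
    Wk = sym (W-return c (ℕ.<-trans i<j j<k) k<2n (trans (at i ei) (sym (at k ek))))
    only-j : ∀ p → 0 < p → p < 2 * n → edgeOf (W c p) ≡ x → p ≡ j
    only-j p 0<p p<2n eq = W-injective c p<2n j<2n (trans (W-return c 0<p p<2n (sym eq)) (sym Wj))
    first : R (single x) (W c i) (W c j)
    first = segment′ x c i j (ℕ.<⇒≤ i<j) λ p i≤p p<j eq →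
      ℕ.<-irrefl (only-j p (ℕ.<-≤-trans 0<i i≤p) (ℕ.<-trans p<j j<2n) eq) p<j
    wrap : R (single x) (W c k) c
    wrap = subst (R (single x) (W c k)) (W-full c) (segment′ x c k (2 * n) (ℕ.<⇒≤ k<2n) λ p k≤p p<2n eq →
      ℕ.<-irrefl (sym (only-j p (ℕ.<-≤-trans (ℕ.<-trans 0<i (ℕ.<-trans i<j j<k)) k≤p) p<2n eq)) (ℕ.<-≤-trans j<k k≤p))

  -- No edge has both ends in the same piece of the circle cut open at another
  -- edge, so each piece has at most n - 1 ends in its interior.
  module Antipodal (separated : ∀ x c → ¬ Joined (single x) c) where

    private
      -- The edges met before `θ c` are distinct, as a repeated one would have both ends in this
      -- piece.
      short : ∀ c m → m < 2 * n → W c m ≡ θ c → m ≤ n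
      short c m m<2n Wm = Fin.injective⇒≤ {f = λ i → edgeOf (W c (toℕ i))} injective
        where
        distinct : ∀ i j → i < j → j < m → edgeOf (W c i) ≢ edgeOf (W c j)
        distinct zero j 0<j j<m eq = ℕ.<-irrefl
          (W-injective c (ℕ.<-trans j<m m<2n) m<2n
            (trans (W-return c 0<j (ℕ.<-trans j<m m<2n) eq) (sym Wm))) j<m
        distinct i@(suc _) j i<j j<m eq = separated (edgeOf c) (W c i)
          (subst (R (single (edgeOf c)) (W c i)) (W-return c i<j (ℕ.<-trans j<m m<2n) eq)
            (segment′ (edgeOf c) c i j (ℕ.<⇒≤ i<j) λ p i≤p p<j eq′ →
              distinct zero p (ℕ.<-≤-trans z<s i≤p) (ℕ.<-trans p<j j<m) (sym eq′)))
        injective : ∀ {i j : Fin m} → edgeOf (W c (toℕ i)) ≡ edgeOf (W c (toℕ j)) → i ≡ j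
        injective {i} {j} eq with Fin.<-cmp i j
        ... | tri< i<j _ _ = contradiction eq (distinct _ _ i<j (Fin.toℕ<n j))
        ... | tri≈ _ i≡j _ = i≡j
        ... | tri> _ _ j<i = contradiction (sym eq) (distinct _ _ j<i (Fin.toℕ<n i))

    -- The two pieces between c and `θ c` have lengths m and l, each at most n, and together they
    -- make at least a full turn of 2n.
    antipodal : ∀ c → W c n ≡ θ c
    antipodal c with reach-2n c (θ c) (sym (o-θ c)) | reach-2n (θ c) c (o-θ c)
    ... | zero , _ , eq | _ = contradiction (sym eq) (θ-free c)
    ... | m@(suc m′) , m<2n , eq | l , l<2n , eq′ = trans (cong (W c) (sym m≡n)) eq
      where
      l≤n : l ≤ n
      l≤n = short (θ c) l l<2n (trans eq′ (sym (θ-involutive c)))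
      2n≤m+l : 2 * n ≤ m + l
      2n≤m+l = period-≥ c (m′ + l) (trans (W-+ c m l) (trans (cong (λ d → W d l) eq) eq′))
      m≡n : m ≡ n
      m≡n = ℕ.≤-antisym (short c m m<2n eq) (ℕ.+-cancelʳ-≤ n n m (begin
        n + n      ≡⟨ cong (λ k → n + k) (ℕ.+-identityʳ n) ⟨
        2 * n      ≤⟨ 2n≤m+l ⟩
        m + l      ≤⟨ ℕ.+-monoʳ-≤ m l≤n ⟩
        m + n      ∎))
        where open ℕ.≤-Reasoning

  -- Consequences of a constant sum `F A + F (∁ A)`

  module Constant (N : ℕ) (constant : ∀ A → F A + F (∁ A) ≡ N) where

    private
      twice-more : ∀ {a b c d} → a ≡ suc c → b ≡ suc d → a + b ≢ c + d
      twice-more {c = c} {d} refl refl eq = ℕ.<-irrefl (sym eq)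
        (ℕ.+-mono-<-≤ (ℕ.n<1+n c) (ℕ.n≤1+n d))

    -- Toggling the edge changes both summands by one; a constant sum forces the changes to have
    -- opposite signs.
    opposite : ∀ A c → (Joined A c × ¬ Joined (∁ A) c) ⊎ (¬ Joined A c × Joined (∁ A) c)
    opposite A c with toggle-splits c T | toggle-splits c (toggles-∁ T)
      where T = toggles-toggle (edgeOf c) A
    ... | inj₁ P | inj₂ Q = inj₂ (Splits.apart P , Splits.together Q)
    ... | inj₂ P | inj₁ Q = inj₁ (Splits.together P , Splits.apart Q)
    ... | inj₁ P | inj₁ Q = contradiction (trans (constant _) (sym (constant _)))
      (twice-more (Splits.one-more P) (Splits.one-more Q))
    ... | inj₂ P | inj₂ Q = contradiction (trans (constant _) (sym (constant _)))
      (twice-more (Splits.one-more P) (Splits.one-more Q))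

    private
      V : Subset n
      V = ∁ ⊥

    full-apart : ∀ c → ¬ Joined V c
    full-apart c with opposite ⊥ c
    ... | inj₁ (_ , ¬s) = ¬s
    ... | inj₂ (¬s , _) = contradiction (R-⊥ c (θ c)) ¬s

    -- The edges of c and d border the same pair of vertices of the partial dual
    -- with respect to all edges.
    Parallel : Rel (Corner n) 0ℓ
    Parallel c d = (R V c d × R V (θ c) (θ d)) ⊎ (R V c (θ d) × R V (θ c) d)

    private
      merges : ∀ d → Merges (R V) (R (∁ (single (edgeOf d)))) d (θ d)
      merges d with toggle-splits d (toggles-∁ (toggles-toggle (edgeOf d) ⊥))
      ... | inj₁ Sp = Splits.merges Sp
      ... | inj₂ Sp = contradiction (Splits.together Sp) (full-apart d)

    -- Removing the edge of d from the full edge set unites the two components that it borders. A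
    -- parallel edge borders the same two, so its sides come together there and are apart for the
    -- complement.
    parallel⇒apart : ∀ {c d} → Parallel c d → ¬ Joined (single (edgeOf d)) c
    parallel⇒apart {c} {d} P s with opposite (single (edgeOf d)) c
    ... | inj₂ (¬s , _) = ¬s s
    ... | inj₁ (_ , ¬s) = ¬s (rejoin P)
      where
      open Merges (merges d)
      rejoin : Parallel c d → Joined (∁ (single (edgeOf d))) c
      rejoin (inj₁ (p , q)) = R.trans (extends p) (R.trans joins (R.sym (extends q)))
      rejoin (inj₂ (p , q)) = R.trans (extends p) (R.trans (R.sym joins) (R.sym (extends q)))

    -- Here the sides of c come together when the edge of d is removed; they were apart before, so
    -- they must be the two components being united.
    apart⇒parallel : ∀ {c d} → ¬ Joined (single (edgeOf d)) c → Parallel c d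
    apart⇒parallel {c} {d} ¬s with opposite (single (edgeOf d)) c
    ... | inj₁ (s , _) = contradiction s ¬s
    ... | inj₂ (_ , s) with Merges.only (merges d) s
    ...   | inj₁ r              = contradiction r (full-apart c)
    ...   | inj₂ (inj₁ (p , q)) = inj₁ (p , R.sym q)
    ...   | inj₂ (inj₂ (p , q)) = inj₂ (p , R.sym q)

    parallel-sym : ∀ {c d} → Parallel c d → Parallel d c
    parallel-sym (inj₁ (p , q)) = inj₁ (R.sym p , R.sym q)
    parallel-sym (inj₂ (p , q)) = inj₂ (R.sym q , R.sym p)

    parallel-trans : ∀ {c d d′} → Parallel c d → Parallel d d′ → Parallel c d′
    parallel-trans (inj₁ (p , q)) (inj₁ (r , s)) = inj₁ (R.trans p r , R.trans q s)
    parallel-trans (inj₁ (p , q)) (inj₂ (r , s)) = inj₂ (R.trans p r , R.trans q s)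
    parallel-trans (inj₂ (p , q)) (inj₁ (r , s)) = inj₂ (R.trans p s , R.trans q r)
    parallel-trans (inj₂ (p , q)) (inj₂ (r , s)) = inj₁ (R.trans p s , R.trans q r)

    parallel-θ : ∀ c → Parallel c (θ c)
    parallel-θ c = inj₂ (R.reflexive (sym (θ-involutive c)) , R.refl)

    parallel-ρ : ∀ c → Parallel c (ρ V c)
    parallel-ρ c = inj₁ (R-ρ c , subst (R V (θ c)) (ρ-θ V c) (R-ρ (θ c)))

    -- Makes `Parallel` a relation between edges, independent of the corners chosen on them.
    parallel-edge : ∀ {c d} → edgeOf d ≡ edgeOf c → Parallel c d
    parallel-edge {c} {d} eq with corner-cases V c d eq
    ... | inj₁ (inj₁ refl) = inj₁ (R.refl , R.refl)
    ... | inj₁ (inj₂ refl) = parallel-θ c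
    ... | inj₂ (inj₁ refl) = parallel-ρ c
    ... | inj₂ (inj₂ refl) = parallel-trans (parallel-θ c) (parallel-ρ (θ c))

    parallel-all : Prime G → ∀ c d → Parallel c d
    parallel-all prime c d = Eq.fold {S = EdgesParallel} equivalence interlaced⇒ (prime (edgeOf c) (edgeOf d)) refl refl
      where
      EdgesParallel : Rel (Fin n) 0ℓ
      EdgesParallel x y = ∀ {c d} → edgeOf c ≡ x → edgeOf d ≡ y → Parallel c d
      equivalence : IsEquivalence EdgesParallel
      equivalence = record
        { refl  = λ eq eq′ → parallel-edge (trans eq′ (sym eq))
        ; sym   = λ P eq eq′ → parallel-sym (P eq′ eq)
        ; trans = λ {_} {y} P Q eq eq′ → parallel-trans (P {d = y , false , false} eq refl) (Q refl eq′)
        }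
      interlaced⇒ : ∀ {x y} → Interlaced G x y → EdgesParallel x y
      interlaced⇒ I refl refl with interlaced-apart I
      ... | d , eq , ¬s = parallel-trans (parallel-sym (apart⇒parallel ¬s)) (parallel-edge (sym eq))

-- The bouquets B[ t ]

%-absorbˡ-+ : ∀ a b m .{{_ : NonZero m}} → (a % m + b) % m ≡ (a + b) % m
%-absorbˡ-+ a b m = trans (%-distribˡ-+ (a % m) b m)
  (trans (cong (λ t → (t + b % m) % m) (m%n%n≡m%n a m)) (sym (%-distribˡ-+ a b m)))

toℕ-next : ∀ {m} .{{_ : NonZero m}} (i : Fin m) → toℕ (next i) ≡ suc (toℕ i) % m
toℕ-next {suc m} i = Fin.toℕ-fromℕ< (m%n<n (suc (toℕ i)) (suc m))

bouquetRotation : ∀ t → SignedRotation t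
bouquetRotation t = record
  { position = ↔-trans (×-comm (Fin t) Bool) (↔-trans (↔-sym Fin.2↔Bool ×-↔ ↔-refl) (↔-sym (Fin.*↔× {2} {t})))
  ; sign     = λ _ → Sign.+
  }

flipHalf : ∀ {t} → HalfEdge t → HalfEdge t
flipHalf (i , h) = i , not h

module Standard (t : ℕ) .{{t≢0 : NonZero t}} where

  private instance
    2t≢0 : NonZero (2 * t)
    2t≢0 = ℕ.m*n≢0 2 t

  open SignedRotation (bouquetRotation t) public using (position)

  place : HalfEdge t → ℕ
  place x = toℕ (Inverse.to position x)

  place-< : ∀ x → place x < 2 * t
  place-< x = Fin.toℕ<n (Inverse.to position x)

  place-injective : ∀ {x y} → place x ≡ place y → x ≡ y
  place-injective {x} {y} eq = begin
    x                                            ≡⟨ Inverse.strictlyInverseʳ position x ⟨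
    Inverse.from position (Inverse.to position x) ≡⟨ cong (Inverse.from position) (Fin.toℕ-injective eq) ⟩
    Inverse.from position (Inverse.to position y) ≡⟨ Inverse.strictlyInverseʳ position y ⟩
    y                                            ∎
    where open ≡-Reasoning

  place-false : ∀ i → place (i , false) ≡ toℕ i
  place-false i = trans (Fin.toℕ-combine {2} zero i) (cong (_+ toℕ i) (ℕ.*-zeroʳ t))

  place-true : ∀ i → place (i , true) ≡ toℕ i + t
  place-true i = trans (Fin.toℕ-combine {2} (suc zero) i)
    (trans (cong (_+ toℕ i) (ℕ.*-identityʳ t)) (ℕ.+-comm t (toℕ i)))

  -- The halves of an edge have positions i and t + i, and adding t twice is a full turn.
  place-flip : ∀ x → place (flipHalf x) ≡ (place x + t) % (2 * t)
  place-flip (i , false) = begin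
    place (i , true)                 ≡⟨ m<n⇒m%n≡m (place-< (i , true)) ⟨
    place (i , true) % (2 * t)       ≡⟨ cong (_% (2 * t)) (trans (place-true i) (cong (_+ t) (sym (place-false i)))) ⟩
    (place (i , false) + t) % (2 * t) ∎
    where open ≡-Reasoning
  place-flip (i , true) = begin
    place (i , false)                 ≡⟨ m<n⇒m%n≡m (place-< (i , false)) ⟨
    place (i , false) % (2 * t)       ≡⟨ [m+n]%n≡m%n (place (i , false)) (2 * t) ⟨
    (place (i , false) + 2 * t) % (2 * t) ≡⟨ cong (_% (2 * t)) shift ⟩
    (place (i , true) + t) % (2 * t)  ∎
    where
    open ≡-Reasoning
    shift : place (i , false) + 2 * t ≡ place (i , true) + t
    shift = begin
      place (i , false) + 2 * t   ≡⟨ cong₂ _+_ (place-false i) (cong (λ k → t + k) (ℕ.+-identityʳ t)) ⟩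
      toℕ i + (t + t)             ≡⟨ ℕ.+-assoc (toℕ i) t t ⟨
      toℕ i + t + t               ≡⟨ cong (_+ t) (place-true i) ⟨
      place (i , true) + t        ∎

  nextH prevH : HalfEdge t → HalfEdge t
  nextH = nextHalf (bouquetRotation t)
  prevH = prevHalf (bouquetRotation t)

  place-next : ∀ x → place (nextH x) ≡ suc (place x) % (2 * t)
  place-next x = trans (cong toℕ (Inverse.strictlyInverseˡ position (next (Inverse.to position x))))
    (toℕ-next (Inverse.to position x))

  next-flip : ∀ x → nextH (flipHalf x) ≡ flipHalf (nextH x)
  next-flip x = place-injective (begin
    place (nextH (flipHalf x))            ≡⟨ place-next (flipHalf x) ⟩
    suc (place (flipHalf x)) % (2 * t)    ≡⟨ cong (λ k → suc k % (2 * t)) (place-flip x) ⟩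
    suc ((place x + t) % (2 * t)) % (2 * t) ≡⟨ cong (_% (2 * t)) (ℕ.+-comm 1 ((place x + t) % (2 * t))) ⟩
    ((place x + t) % (2 * t) + 1) % (2 * t) ≡⟨ %-absorbˡ-+ (place x + t) 1 (2 * t) ⟩
    (place x + t + 1) % (2 * t)           ≡⟨ cong (_% (2 * t)) (ℕ.+-comm (place x + t) 1) ⟩
    (suc (place x) + t) % (2 * t)         ≡⟨ %-absorbˡ-+ (suc (place x)) t (2 * t) ⟨
    (suc (place x) % (2 * t) + t) % (2 * t) ≡⟨ cong (λ k → (k + t) % (2 * t)) (place-next x) ⟨
    (place (nextH x) + t) % (2 * t)       ≡⟨ place-flip (nextH x) ⟨
    place (flipHalf (nextH x))            ∎)
    where open ≡-Reasoning

  prev-flip : ∀ x → prevH (flipHalf x) ≡ flipHalf (prevH x)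
  prev-flip x = begin
    prevH (flipHalf x)                   ≡⟨ cong (prevH ∘ flipHalf) (next-prevHalf (bouquetRotation t) x) ⟨
    prevH (flipHalf (nextH (prevH x)))   ≡⟨ cong prevH (next-flip (prevH x)) ⟨
    prevH (nextH (flipHalf (prevH x)))   ≡⟨ prev-nextHalf (bouquetRotation t) (flipHalf (prevH x)) ⟩
    flipHalf (prevH x)                   ∎
    where open ≡-Reasoning

  arcS : Corner t → Corner t
  arcS = sortedArc (bouquetRotation t)

  sortS : Corner t → Corner t
  sortS = sort (bouquetRotation t)

  -- The antipodal map in sorted names, where first corners go to first corners. Since all signs are
  -- +, sorting turns it into θ.
  flipC : Corner t → Corner t
  flipC (i , h , s) = i , not h , s

  sort-θ : ∀ c → sortS (θ c) ≡ flipC (sortS c)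
  sort-θ (i , h , s) = cong (λ b → i , not h , b)
    (trans (sym (Bool.not-distribˡ-xor s (not h))) (trans (cong not (sym (Bool.not-distribʳ-xor s h))) (Bool.not-involutive (s xor h))))

  sort-flip : ∀ c → sortS (flipC c) ≡ θ (sortS c)
  sort-flip (i , h , s) = cong (λ b → i , not h , b) (sym (Bool.not-distribʳ-xor s h))

  arc-flip : ∀ c → arcS (flipC c) ≡ flipC (arcS c)
  arc-flip (i , h , true)  = cong (λ (x : HalfEdge t) → proj₁ x , proj₂ x , false) (next-flip (i , h))
  arc-flip (i , h , false) = cong (λ (x : HalfEdge t) → proj₁ x , proj₂ x , true) (prev-flip (i , h))

  arc-θ : ∀ c → arc B[ t ] (θ c) ≡ θ (arc B[ t ] c)
  arc-θ c = begin
    sortS (arcS (sortS (θ c)))      ≡⟨ cong (sortS ∘ arcS) (sort-θ c) ⟩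
    sortS (arcS (flipC (sortS c)))  ≡⟨ cong sortS (arc-flip (sortS c)) ⟩
    sortS (flipC (arcS (sortS c)))  ≡⟨ sort-flip (arcS (sortS c)) ⟩
    θ (sortS (arcS (sortS c)))      ∎
    where open ≡-Reasoning

-- Transport along equivalences

corner↔Fin : ∀ n → Corner n ↔ Fin (n * 4)
corner↔Fin n = ↔-trans (↔-refl ×-↔ ↔-trans (↔-sym Fin.2↔Bool ×-↔ ↔-sym Fin.2↔Bool) (↔-sym (Fin.*↔× {2} {2})))
  (↔-sym (Fin.*↔× {n} {4}))

module _ {G H : RibbonGraph} (G≅H : G ≅ H) where
  open _≅_ G≅H

  ≅⇒edges-≡ : edges G ≡ edges H
  ≅⇒edges-≡ = ℕ.*-cancelʳ-≡ (edges G) (edges H) 4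
    (Permutation.↔⇒≡ (↔-trans (↔-sym (corner↔Fin (edges G))) (↔-trans corners (corner↔Fin (edges H)))))

  ≅-arc-θ : (∀ c → arc H (θ c) ≡ θ (arc H c)) → ∀ c → arc G (θ c) ≡ θ (arc G c)
  ≅-arc-θ comm c = begin
    arc G (θ c)             ≡⟨ strictlyInverseʳ _ ⟨
    from (to (arc G (θ c))) ≡⟨ cong from (arc-commutes (θ c)) ⟩
    from (arc H (to (θ c))) ≡⟨ cong (from ∘ arc H) (to-θ c) ⟩
    from (arc H (θ (to c))) ≡⟨ cong from (comm (to c)) ⟩
    from (θ (arc H (to c))) ≡⟨ cong (from ∘ θ) (arc-commutes c) ⟨
    from (θ (to (arc G c))) ≡⟨ cong from (to-θ (arc G c)) ⟨
    from (to (θ (arc G c))) ≡⟨ strictlyInverseʳ _ ⟩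
    θ (arc G c)             ∎
    where
    open ≡-Reasoning
    open Inverse corners
    to-θ : ∀ c → to (θ c) ≡ θ (to c)
    to-θ c = trans (end-commutes (side c)) (cong end (side-commutes c))

isolated-B : ∀ t → 1 ≤ t → isolated B[ t ] ≡ 0
isolated-B (suc t) _ = refl

module _ {G H : RibbonGraph} (ψ : Corner (edges H) → Corner (edges G)) (χ : Corner (edges G) → Corner (edges H))
         (ψ-injective : ∀ {c d} → ψ c ≡ ψ d → c ≡ d) (ψχ : ∀ c → ψ (χ c) ≡ c) where

  private
    χ-commutes : ∀ (r : Corner (edges H) → Corner (edges H)) (r′ : Corner (edges G) → Corner (edges G)) →
      (∀ c → ψ (r c) ≡ r′ (ψ c)) → ∀ c → χ (r′ c) ≡ r (χ c)
    χ-commutes r r′ comm c = ψ-injective (trans (ψχ (r′ c)) (trans (cong r′ (sym (ψχ c))) (sym (comm (χ c)))))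

  bijection⇒≅ : (∀ c → ψ (end c) ≡ end (ψ c)) → (∀ c → ψ (side c) ≡ side (ψ c)) →
    (∀ c → ψ (arc H c) ≡ arc G (ψ c)) → isolated G ≡ isolated H → G ≅ H
  bijection⇒≅ ψ-end ψ-side ψ-arc isolated≡ = record
    { corners       = mk↔ₛ′ χ ψ (λ c → ψ-injective (ψχ (ψ c))) ψχ
    ; end-commutes  = χ-commutes end end ψ-end
    ; side-commutes = χ-commutes side side ψ-side
    ; arc-commutes  = χ-commutes (arc H) (arc G) ψ-arc
    ; isolated-≡    = isolated≡
    }

-- Recognition of `B[ n ]` and the values of F

module Main (G : RibbonGraph) (O : Orientable G) (bouquet : Bouquet G) (nonempty : 1 ≤ e G) where
  open Circle G O bouquet nonempty

  private instance
    n≢0 : NonZero n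
    n≢0 = >-nonZero nonempty
    2n≢0 : NonZero (2 * n)
    2n≢0 = ℕ.m*n≢0 2 n

  open Standard n

  module _ (antipodal : ∀ c → W c n ≡ θ c) where

    private
      Wᵖ : HalfEdge n → Corner n
      Wᵖ x = W c₀ (place x)

      turn : Bool → Corner n → Corner n
      turn true  c = end c
      turn false c = c

      o-turn : ∀ b c → o (turn b c) ≡ b xor o c
      o-turn true  c = o-end c
      o-turn false c = refl

      turn-not : ∀ b c → turn (not b) c ≡ end (turn b c)
      turn-not true  c = sym (end-involutive c)
      turn-not false c = refl

      turn-θ : ∀ b c → turn (not b) (θ c) ≡ side (turn b c)
      turn-θ true  c           = refl
      turn-θ false (i , h , s) = cong (λ b → i , not h , b) (Bool.not-involutive s)

      turn-injective : ∀ b {c d} → turn b c ≡ turn b d → c ≡ d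
      turn-injective false eq = eq
      turn-injective true {c} {d} eq = trans (sym (end-involutive c)) (trans (cong end eq) (end-involutive d))

      -- Lays the circle of `B[ n ]`, in sorted names, along the walk from `c₀`: the first corner of
      -- a half-edge goes to the corner at its place, the second to the other corner of that end.
      ψ′ : Corner n → Corner n
      ψ′ (i , h , s) = turn s (Wᵖ (i , h))

      ψ : Corner n → Corner n
      ψ = ψ′ ∘ sortS

      W-% : ∀ k → W c₀ (k % (2 * n)) ≡ W c₀ k
      W-% k = iterate-% (π ⊥) (2 * n) k (W-full c₀)

      Wᵖ-flip : ∀ x → Wᵖ (flipHalf x) ≡ θ (Wᵖ x)
      Wᵖ-flip x = begin
        W c₀ (place (flipHalf x))          ≡⟨ cong (W c₀) (place-flip x) ⟩
        W c₀ ((place x + n) % (2 * n))     ≡⟨ W-% (place x + n) ⟩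
        W c₀ (place x + n)                 ≡⟨ W-+ c₀ (place x) n ⟩
        W (W c₀ (place x)) n               ≡⟨ antipodal (Wᵖ x) ⟩
        θ (Wᵖ x)                           ∎
        where open ≡-Reasoning

      Wᵖ-next : ∀ x → Wᵖ (nextH x) ≡ α (end (Wᵖ x))
      Wᵖ-next x = begin
        W c₀ (place (nextH x))             ≡⟨ cong (W c₀) (place-next x) ⟩
        W c₀ (suc (place x) % (2 * n))     ≡⟨ W-% (suc (place x)) ⟩
        W c₀ (suc (place x))               ≡⟨ iterate-step (π ⊥) c₀ (place x) ⟩
        α (ρ ⊥ (Wᵖ x))                     ≡⟨ cong α (ρ-⊥ (Wᵖ x)) ⟩
        α (end (Wᵖ x))                     ∎
        where open ≡-Reasoning

      ψ′-arc : ∀ c → ψ′ (arcS c) ≡ α (ψ′ c)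
      ψ′-arc (i , h , true)  = Wᵖ-next (i , h)
      ψ′-arc c@(i , h , false) = begin
        ψ′ (arcS c)              ≡⟨ α-involutive _ ⟨
        α (α (ψ′ (arcS c)))      ≡⟨ cong α (Wᵖ-next (prevH (i , h))) ⟨
        α (ψ′ (arcS (arcS c)))   ≡⟨ cong (α ∘ ψ′) (sortedArc-involutive (bouquetRotation n) c) ⟩
        α (ψ′ c)                 ∎
        where open ≡-Reasoning

      ψ-arc : ∀ c → ψ (arc B[ n ] c) ≡ α (ψ c)
      ψ-arc c = trans (cong ψ′ (sort-involutive (bouquetRotation n) (arcS (sortS c)))) (ψ′-arc (sortS c))

      ψ-end : ∀ c → ψ (end c) ≡ end (ψ c)
      ψ-end (i , h , s) = trans (cong (λ b → turn b (Wᵖ (i , h))) (sym (Bool.not-distribˡ-xor s h)))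
        (turn-not (s xor h) (Wᵖ (i , h)))

      ψ-side : ∀ c → ψ (side c) ≡ side (ψ c)
      ψ-side (i , h , s) = trans
        (cong₂ turn (sym (Bool.not-distribʳ-xor s h)) (Wᵖ-flip (i , h)))
        (turn-θ (s xor h) (Wᵖ (i , h)))

      -- The value of o recovers s; the walk then recovers the place, since it repeats no corner
      -- within 2n steps.
      ψ′-injective : ∀ c d → ψ′ c ≡ ψ′ d → c ≡ d
      ψ′-injective (i , h , s) (j , g , r) eq = cong₂ (corner (bouquetRotation n)) half≡ same
        where
        orientation : ∀ s x → o (turn s (Wᵖ x)) ≡ s xor o c₀
        orientation s x = trans (o-turn s (Wᵖ x)) (cong (s xor_) (o-W c₀ (place x)))
        same : s ≡ r
        same = xor-cancel s r (trans (sym (orientation s (i , h))) (trans (cong o eq) (orientation r (j , g))))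
          where
          xor-cancel : ∀ x y {z} → x xor z ≡ y xor z → x ≡ y
          xor-cancel true  true  _ = refl
          xor-cancel false false _ = refl
          xor-cancel true  false eq = contradiction (sym eq) (Bool.not-¬ refl)
          xor-cancel false true  eq = contradiction eq (Bool.not-¬ refl)
        half≡ : (i , h) ≡ (j , g)
        half≡ = place-injective (W-injective c₀ (place-< (i , h)) (place-< (j , g))
          (turn-injective s (trans eq (cong (λ b → turn b (Wᵖ (j , g))) (sym same)))))

      ψ-injective : ∀ {c d} → ψ c ≡ ψ d → c ≡ d
      ψ-injective {c} {d} eq = begin
        c                 ≡⟨ sort-involutive (bouquetRotation n) c ⟨
        sortS (sortS c)   ≡⟨ cong sortS (ψ′-injective (sortS c) (sortS d) eq) ⟩
        sortS (sortS d)   ≡⟨ sort-involutive (bouquetRotation n) d ⟩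
        d                 ∎
        where open ≡-Reasoning

      half : ∀ {k} → k < 2 * n → HalfEdge n
      half k< = Inverse.from position (fromℕ< k<)

      place-half : ∀ {k} (k< : k < 2 * n) → place (half k<) ≡ k
      place-half k< = trans (cong toℕ (Inverse.strictlyInverseˡ position (fromℕ< k<))) (Fin.toℕ-fromℕ< k<)

      -- The walk from `c₀` meets all corners with its value of o; any other corner is the `end` of
      -- one of these.
      ψ-surjective : ∀ c → ∃[ d ] ψ d ≡ c
      ψ-surjective c with o c₀ Bool.≟ o c
      ... | yes o≡ with reach-2n c₀ c o≡
      ...   | k , k< , eq = sortS (corner (bouquetRotation n) (half k<) false) ,
        trans (cong ψ′ (sort-involutive (bouquetRotation n) (corner (bouquetRotation n) (half k<) false)))
          (trans (cong (W c₀) (place-half k<)) eq)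
      ψ-surjective c | no o≢ with reach-2n c₀ (end c) (trans (Bool.¬-not o≢) (sym (o-end c)))
      ...   | k , k< , eq = sortS (corner (bouquetRotation n) (half k<) true) ,
        trans (cong ψ′ (sort-involutive (bouquetRotation n) (corner (bouquetRotation n) (half k<) true)))
          (trans (cong end (trans (cong (W c₀) (place-half k<)) eq)) (end-involutive c))

    antipodal⇒≅ : G ≅ B[ n ]
    antipodal⇒≅ = bijection⇒≅ ψ (proj₁ ∘ ψ-surjective) ψ-injective (proj₂ ∘ ψ-surjective) ψ-end ψ-side ψ-arc
      (trans isolated-0 (sym (isolated-B n nonempty)))

  module _ (prime : Prime G) (N : ℕ) (constant : ∀ A → F A + F (∁ A) ≡ N) where
    open Constant N constant

    constant⇒≅ : G ≅ B[ n ]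
    constant⇒≅ = antipodal⇒≅ (Antipodal.antipodal λ x c →
      parallel⇒apart {d = x , false , false} (parallel-all prime c (x , false , false)))

    private
      -- All edges border the two components at `c₀` and `θ c₀`, which differ by `full-apart`.
      F-full : F (∁ ⊥) ≡ 2
      F-full = ℕ.≤-antisym
        (classes-≤2 classes c₀ (θ c₀) λ c → cover (parallel-all prime c₀ c))
        (two (HasClasses.class classes c₀) (HasClasses.class classes (θ c₀)) (full-apart c₀ ∘ HasClasses.sound classes))
        where
        classes : HasClasses (R (∁ ⊥)) (F (∁ ⊥))
        classes = orbits-classes (ρ (∁ ⊥)) α
        cover : ∀ {c} → Parallel c₀ c → R (∁ ⊥) c₀ c ⊎ R (∁ ⊥) (θ c₀) c
        cover (inj₁ (p , _)) = inj₁ p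
        cover (inj₂ (_ , q)) = inj₂ q
        two : ∀ {k} (i j : Fin k) → i ≢ j → 2 ≤ k
        two {suc zero} zero zero i≢j = contradiction refl i≢j
        two {suc (suc k)} _ _ _ = s≤s (s≤s z≤n)

    constant⇒odd : ∃[ i ] n ≡ 2 * i + 1
    constant⇒odd = parity-odd n (trans (sym (F-parity ⊥))
      (cong₂ (λ a b → parity a +ℙ parity b) F-⊥ F-full))

  -- The bound on F from antipodal symmetry

  module _ (i : ℕ) (odd : n ≡ 2 * i + 1) (commutes : ∀ c → α (θ c) ≡ θ (α c)) where

    private
      R-θ : ∀ {A c d} → R A c d → R A (θ c) (θ d)
      R-θ {A} = Eq.gmap θ λ
        { (inj₁ refl) → inj₁ (ρ-θ A _)
        ; (inj₂ refl) → inj₂ (commutes _) }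

      Covered : Subset n → Corner n → Set
      Covered A c = R A c₀ c ⊎ R A (θ c₀) c

      covered-R : ∀ {A c d} → Covered A c → R A c d → Covered A d
      covered-R (inj₁ p) r = inj₁ (R.trans p r)
      covered-R (inj₂ p) r = inj₂ (R.trans p r)

      covered-θ : ∀ {A c} → Covered A c → Covered A (θ c)
      covered-θ     (inj₁ p) = inj₂ (R-θ p)
      covered-θ {A} {c} (inj₂ p) = inj₁ (subst (λ d → R A d (θ c)) (θ-involutive c₀) (R-θ p))

      θ-side : ∀ (c : Corner n) → θ (side c) ≡ end c
      θ-side (i , h , s) = cong (λ b → i , b , not s) (Bool.not-involutive h)

      -- On an edge in A the relation supplies `side` instead of `end`; the antipodal map makes up
      -- the difference. Hence a walk around the vertex stays covered.
      covered-end : ∀ A c → Covered A c → Covered A (end c)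
      covered-end A c C with lookup A (edgeOf c) in eq
      ... | true  = subst (Covered A) (trans (cong θ (ρ-∈ A c eq)) (θ-side c)) (covered-θ (covered-R C (R-ρ c)))
      ... | false = subst (Covered A) (ρ-∉ A c eq) (covered-R C (R-ρ c))

      covered-walk : ∀ A k c → Covered A c → Covered A (W c k)
      covered-walk A zero    c C = C
      covered-walk A (suc k) c C = covered-walk A k (π ⊥ c)
        (subst (Covered A ∘ α) (sym (ρ-⊥ c)) (covered-R (covered-end A c C) (R-α (end c))))

      covered : ∀ A c → Covered A c
      covered A c with o c₀ Bool.≟ o c
      ... | yes o≡ with reach-2n c₀ c o≡
      ...   | k , _ , refl = covered-walk A k c₀ (inj₁ R.refl)
      covered A c | no o≢ with reach-2n c₀ (end c) (trans (Bool.¬-not o≢) (sym (o-end c)))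
      ...   | k , _ , eq = subst (Covered A) (end-involutive c) (covered-end A (end c)
        (subst (Covered A) eq (covered-walk A k c₀ (inj₁ R.refl))))

      F-≤2 : ∀ A → F A ≤ 2
      F-≤2 A = classes-≤2 (orbits-classes (ρ A) α) c₀ (θ c₀) (covered A)

      -- The elements of `Fin a` and `Fin b` exclude 0, and odd parity then leaves only 1 + 2 and 2
      -- + 1.
      sum-3 : ∀ a b → Fin a → Fin b → a ≤ 2 → b ≤ 2 → parity a +ℙ parity b ≡ 1ℙ → a + b ≡ 3
      sum-3 1 2 _ _ _ _ _ = refl
      sum-3 2 1 _ _ _ _ _ = refl
      sum-3 1 1 _ _ _ _ ()
      sum-3 2 2 _ _ _ _ ()
      sum-3 (suc (suc (suc _))) _ _ _ (s≤s (s≤s ())) _ _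
      sum-3 1 (suc (suc (suc _))) _ _ _ (s≤s (s≤s ())) _
      sum-3 2 (suc (suc (suc _))) _ _ _ (s≤s (s≤s ())) _

    commutes⇒constant : ∀ A → F A + F (∁ A) ≡ 3
    commutes⇒constant A = sum-3 (F A) (F (∁ A)) (vertex A) (vertex (∁ A)) (F-≤2 A) (F-≤2 (∁ A))
      (trans (F-parity A) (trans (cong parity odd) (odd-parity i)))
      where
      vertex : ∀ A → Fin (F A)
      vertex A = HasClasses.class (orbits-classes (ρ A) α) c₀

theorem27 : (B : RibbonGraph) → Bouquet B → 1 ≤ e B → Prime B → Orientable B →
    (∃[ b ] ∂ε B ≈ (2 ^ e B) · z^ (+ b)) ⇔ (∃[ i ] B ≅ B[ 2 * i + 1 ])
theorem27 B bouquet nonempty prime O = mk⇔ forth back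
  where
  open Main B O bouquet nonempty
  open Bouquets B O bouquet nonempty
  forth : ∃[ b ] ∂ε B ≈ (2 ^ e B) · z^ (+ b) → ∃[ i ] B ≅ B[ 2 * i + 1 ]
  forth (b , eq) = map₂ (λ n≡ → subst (λ t → B ≅ B[ t ]) n≡ (constant⇒≅ prime (F ⊥ + F (∁ ⊥)) constant))
    (constant⇒odd prime (F ⊥ + F (∁ ⊥)) constant)
    where
    genus≡b : ∀ A → eulerGenus (partialDual B A) ≡ + b
    genus≡b A = monomial⇒constant _ (subsets (e B)) (length-subsets (e B)) eq (∈-subsets A)
    constant : ∀ A → F A + F (∁ A) ≡ F ⊥ + F (∁ ⊥)
    -- The genus determines the sum because the number of edges is the same for all partial duals.
    constant A = ℤ.+-injective (ℤ.neg-injective (∙-cancelˡ (+ (2 + n)) _ _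
      (trans (sym (genus A)) (trans (genus≡b A) (trans (sym (genus≡b ⊥)) (genus ⊥))))))
  back : ∃[ i ] B ≅ B[ 2 * i + 1 ] → ∃[ b ] ∂ε B ≈ (2 ^ e B) · z^ (+ b)
  -- The exponent is 2 + n - 3 with n = 2i + 1.
  back (i , B≅) = 2 * i , constant⇒monomial _ (subsets (e B)) (length-subsets (e B)) λ A → begin
    eulerGenus (partialDual B A)           ≡⟨ genus A ⟩
    + (2 + n) - + (F A + F (∁ A))          ≡⟨ cong₂ (λ k l → + (2 + k) - + l) odd (commutes⇒constant i odd commutes A) ⟩
    + (2 + (2 * i + 1)) - + 3              ≡⟨ cong (λ k → + (2 + k) - + 3) (ℕ.+-comm (2 * i) 1) ⟩
    + (3 + 2 * i) - + 3                    ≡⟨ ℤ.m-n≡m⊖n (3 + 2 * i) 3 ⟩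
    (3 + 2 * i) ⊖ 3                        ≡⟨ ℤ.⊖-≥ (s≤s (s≤s (s≤s z≤n))) ⟩
    + (2 * i)                              ∎
    where
    open ≡-Reasoning
    instance
      t≢0 : NonZero (2 * i + 1)
      t≢0 = subst NonZero (ℕ.+-comm 1 (2 * i)) _
    odd : n ≡ 2 * i + 1
    odd = ≅⇒edges-≡ B≅
    commutes : ∀ c → α (θ c) ≡ θ (α c)
    commutes = ≅-arc-θ B≅ (Standard.arc-θ (2 * i + 1))
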